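{- There exist sequences of real numbers $\delta_n\to0$ and $\delta'_n\to 0$ such that, with probability tending to $1$ as $n\to\infty$ over $G\sim G(n,1/2)$, for every positive integer $k\le \dfrac{n}{e\cdot 2(1+\delta'_n)\log_2 n}$ there is no degree $8(1+\delta_n)\log_2 n$ coloring pseudo-expectation for $G$ using $k$ colors.
   Context: $G(n,1/2)$ is the distribution on graphs with vertex set $[n]$ in which each pair $\{i,j\}$ is included as an edge independently with probability $1/2$. $E(G)$ is the edge set of $G$; $e$ is the base of the natural logarithm. A degree $d$ coloring pseudo-expectation for $G$ using $k$ colors is a linear operator $\tilde{\mathbb{E}}$ mapping real polynomials of degree $\le d$ in the variables $\{x_{i,c}\}_{i\in[n],c\in[k]}$ to $\mathbb{R}$ such that: 1. $\tilde{\mathbb{E}}[1]=1$; 2. $\tilde{\mathbb{E}}[f^2]\ge 0$ for every polynomial $f$ of degree at most $d/2$; 3. (a) $\tilde{\mathbb{E}}[f\cdot(x_{i,c}^2-x_{i,c})]=0$ for every polynomial $f$ of degree at most $d-2$ and all $i\in[n],c\in[k]$; (b) $\tilde{\mathbb{E}}[f\cdot x_{i,c}x_{j,c}]=0$ for every polynomial $f$ of degree at most $d-2$, every edge $\{i,j\}\in E(G)$ and every $c\in[k]$; (c) $\tilde{\mathbb{E}}[f^2\cdot(\sum_{c\in[k]}x_{i,c}-1)]\ge 0$ for every polynomial $f$ of degree at most $\frac{d-1}{2}$ and every $i\in[n]$. Here $d$ may be any real degree bound. -}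

module Defs where

open import Algebra.Bundles using (CommutativeRing)
import Algebra.Properties.CommutativeMonoid.Sum as MonoidSum
open import Data.Bool using (Bool; true; false; if_then_else_; T)
open import Data.Fin as Fin using (Fin)
open import Data.Integer as ℤ using (+_)
import Data.Integer.Properties as ℤ
open import Data.Integer.Tactic.RingSolver using (solve-∀)
open import Data.Nat as ℕ using (ℕ; zero; suc; _!)
open import Data.Nat.Induction using (<-rec)
open import Data.Nat.Logarithm
import Data.Nat.Properties as ℕ
open import Data.Product using (Σ; ∃-syntax; _×_; _,_)
open import Data.Rational as ℚ using (ℚ; 0ℚ; 1ℚ; ½; _/_)
import Data.Rational.Properties as ℚ
open import Data.Rational.Solver using (module +-*-Solver)
import Data.Rational.Unnormalised as ℚᵘ
import Data.Rational.Unnormalised.Properties as ℚᵘ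
open import Data.Sum using (_⊎_; inj₁; inj₂)
open import Data.Vec using (Vec; []; _∷_; lookup)
open import Level using (0ℓ)
open import Relation.Binary.Bundles using (Setoid)
open import Relation.Binary.Structures using (IsEquivalence)
open import Relation.Binary.PropositionalEquality

------------------------------------------------------------------------
-- Rational estimates

module RationalEstimates where

  ∣p-q∣≡∣q-p∣ : ∀ p q → ℚ.∣ p ℚ.- q ∣ ≡ ℚ.∣ q ℚ.- p ∣
  ∣p-q∣≡∣q-p∣ p q = begin
    ℚ.∣ p ℚ.- q ∣          ≡⟨ ℚ.∣-p∣≡∣p∣ (p ℚ.- q) ⟨
    ℚ.∣ ℚ.- (p ℚ.- q) ∣    ≡⟨ cong ℚ.∣_∣ (solve 2 (λ p q → :- (p :- q) := q :- p) refl p q) ⟩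
    ℚ.∣ q ℚ.- p ∣          ∎
    where
    open ≡-Reasoning
    open +-*-Solver

  triangle : ∀ p q r → ℚ.∣ p ℚ.- r ∣ ℚ.≤ ℚ.∣ p ℚ.- q ∣ ℚ.+ ℚ.∣ q ℚ.- r ∣
  triangle p q r = subst (λ z → ℚ.∣ z ∣ ℚ.≤ ℚ.∣ p ℚ.- q ∣ ℚ.+ ℚ.∣ q ℚ.- r ∣)
    (solve 3 (λ p q r → (p :- q) :+ (q :- r) := p :- r) refl p q r)
    (ℚ.∣p+q∣≤∣p∣+∣q∣ (p ℚ.- q) (q ℚ.- r))
    where
    open +-*-Solver

  p≤q+r⇒p-q≤r : ∀ {p q r} → p ℚ.≤ q ℚ.+ r → p ℚ.- q ℚ.≤ r
  p≤q+r⇒p-q≤r {p} {q} {r} h = subst (p ℚ.- q ℚ.≤_)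
    (solve 2 (λ q r → (q :+ r) :- q := r) refl q r) (ℚ.+-monoˡ-≤ (ℚ.- q) h)
    where
    open +-*-Solver

  ∣p-q∣≤r : ∀ {p q r} → p ℚ.≤ q ℚ.+ r → q ℚ.≤ p ℚ.+ r → ℚ.∣ p ℚ.- q ∣ ℚ.≤ r
  ∣p-q∣≤r {p} {q} {r} h k with ℚ.∣p∣≡p∨∣p∣≡-p (p ℚ.- q)
  ... | inj₁ eq = subst (ℚ._≤ r) (sym eq) (p≤q+r⇒p-q≤r h)
  ... | inj₂ eq = subst (ℚ._≤ r)
    (sym (trans eq (solve 2 (λ p q → :- (p :- q) := q :- p) refl p q)))
    (p≤q+r⇒p-q≤r k)
    where
    open +-*-Solver

  p≡q⇒∣p-q∣≤ε : ∀ {p q ε} → p ≡ q → 0ℚ ℚ.< ε → ℚ.∣ p ℚ.- q ∣ ℚ.≤ ε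
  p≡q⇒∣p-q∣≤ε {p} {ε = ε} refl 0<ε =
    subst (ℚ._≤ ε) (cong ℚ.∣_∣ (sym (ℚ.+-inverseʳ p))) (ℚ.<⇒≤ 0<ε)

  0<½*ε : ∀ {ε} → 0ℚ ℚ.< ε → 0ℚ ℚ.< ½ ℚ.* ε
  0<½*ε {ε} 0<ε = ℚ.*-monoʳ-<-pos ½ 0<ε

  halves : ∀ ε → ½ ℚ.* ε ℚ.+ ½ ℚ.* ε ≡ ε
  halves ε = trans (sym (ℚ.*-distribʳ-+ ε ½ ½)) (ℚ.*-identityˡ ε)

  add-halves : ∀ {p q} ε → p ℚ.≤ ½ ℚ.* ε → q ℚ.≤ ½ ℚ.* ε → p ℚ.+ q ℚ.≤ ε
  add-halves ε h k = subst (_ ℚ.≤_) (halves ε) (ℚ.+-mono-≤ h k)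

  /-mono-≤ : ∀ a p b q .{{_ : ℕ.NonZero p}} .{{_ : ℕ.NonZero q}} →
             a ℕ.* q ℕ.≤ b ℕ.* p → + a / p ℚ.≤ + b / q
  /-mono-≤ a (suc p) b (suc q) h = ℚ.toℚᵘ-cancel-≤
    (ℚᵘ.≤-respˡ-≃ (ℚᵘ.≃-sym (ℚ.toℚᵘ-fromℚᵘ (ℚᵘ.mkℚᵘ (+ a) p)))
    (ℚᵘ.≤-respʳ-≃ (ℚᵘ.≃-sym (ℚ.toℚᵘ-fromℚᵘ (ℚᵘ.mkℚᵘ (+ b) q)))
    (ℚᵘ.*≤* (subst₂ ℤ._≤_ (ℤ.pos-* a (suc q)) (ℤ.pos-* b (suc p)) (ℤ.+≤+ h)))))

  archimedean : ∀ {ε} → 0ℚ ℚ.< ε → ∃[ N ] + 1 / suc N ℚ.≤ ε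
  archimedean {ε@record{}} 0<ε with ℚ.positive 0<ε
  archimedean {ε@(ℚ.mkℚ ℤ.+[1+ n ] d c)} 0<ε | _ = d ,
    subst (+ 1 / suc d ℚ.≤_) (ℚ.↥p/↧p≡p ε)
      (/-mono-≤ 1 (suc d) (suc n) (suc d) (ℕ.*-monoˡ-≤ (suc d) (ℕ.s≤s (ℕ.z≤n {n}))))

  ∣p+q-r-s∣≤ε : ∀ p q r s {ε} → ℚ.∣ p ℚ.- r ∣ ℚ.≤ ½ ℚ.* ε → ℚ.∣ q ℚ.- s ∣ ℚ.≤ ½ ℚ.* ε →
                ℚ.∣ (p ℚ.+ q) ℚ.- (r ℚ.+ s) ∣ ℚ.≤ ε
  ∣p+q-r-s∣≤ε p q r s {ε} h k = subst (λ z → ℚ.∣ z ∣ ℚ.≤ ε)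
    (solve 4 (λ p q r s → (p :- r) :+ (q :- s) := (p :+ q) :- (r :+ s)) refl p q r s)
    (ℚ.≤-trans (ℚ.∣p+q∣≤∣p∣+∣q∣ (p ℚ.- r) (q ℚ.- s)) (add-halves ε h k))
    where
    open +-*-Solver

  ∣-p--q∣≤ε : ∀ p q {ε} → ℚ.∣ p ℚ.- q ∣ ℚ.≤ ε → ℚ.∣ ℚ.- p ℚ.- ℚ.- q ∣ ℚ.≤ ε
  ∣-p--q∣≤ε p q {ε} h = subst (ℚ._≤ ε) (trans (∣p-q∣≡∣q-p∣ p q)
    (cong ℚ.∣_∣ (solve 2 (λ p q → q :- p := (:- p) :- (:- q)) refl p q))) h
    where
    open +-*-Solver

  ∣pq-rs∣≤ : ∀ p q r s {A B a b} → ℚ.∣ p ∣ ℚ.≤ A → ℚ.∣ s ∣ ℚ.≤ B →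
             ℚ.∣ q ℚ.- s ∣ ℚ.≤ a → ℚ.∣ p ℚ.- r ∣ ℚ.≤ b →
             ℚ.∣ p ℚ.* q ℚ.- r ℚ.* s ∣ ℚ.≤ A ℚ.* a ℚ.+ B ℚ.* b
  ∣pq-rs∣≤ p q r s {A} {B} {a} {b} hp hs hqs hpr = begin
    ℚ.∣ p ℚ.* q ℚ.- r ℚ.* s ∣
      ≡⟨ cong ℚ.∣_∣ (solve 4 (λ p q r s → p :* q :- r :* s := p :* (q :- s) :+ s :* (p :- r)) refl p q r s) ⟩
    ℚ.∣ p ℚ.* (q ℚ.- s) ℚ.+ s ℚ.* (p ℚ.- r) ∣
      ≤⟨ ℚ.∣p+q∣≤∣p∣+∣q∣ (p ℚ.* (q ℚ.- s)) (s ℚ.* (p ℚ.- r)) ⟩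
    ℚ.∣ p ℚ.* (q ℚ.- s) ∣ ℚ.+ ℚ.∣ s ℚ.* (p ℚ.- r) ∣
      ≡⟨ cong₂ ℚ._+_ (ℚ.∣p*q∣≡∣p∣*∣q∣ p (q ℚ.- s)) (ℚ.∣p*q∣≡∣p∣*∣q∣ s (p ℚ.- r)) ⟩
    ℚ.∣ p ∣ ℚ.* ℚ.∣ q ℚ.- s ∣ ℚ.+ ℚ.∣ s ∣ ℚ.* ℚ.∣ p ℚ.- r ∣
      ≤⟨ ℚ.+-mono-≤ (mono {p} {A} hp hqs) (mono {s} {B} hs hpr) ⟩
    A ℚ.* a ℚ.+ B ℚ.* b ∎
    where
    open ℚ.≤-Reasoning
    open +-*-Solver
    mono : ∀ {x C y c} → ℚ.∣ x ∣ ℚ.≤ C → ℚ.∣ y ∣ ℚ.≤ c → ℚ.∣ x ∣ ℚ.* ℚ.∣ y ∣ ℚ.≤ C ℚ.* c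
    mono {x} {C} {y} {c} h k = ℚ.≤-trans
      (ℚ.*-monoʳ-≤-nonNeg ℚ.∣ y ∣ {{ℚ.∣-∣-nonNeg y}} h)
      (ℚ.*-monoˡ-≤-nonNeg C {{ℚ.nonNegative (ℚ.≤-trans (ℚ.0≤∣p∣ x) h)}} k)

  scale : ∀ {A ε} → 0ℚ ℚ.< A → 0ℚ ℚ.< ε → ∃[ r ] 0ℚ ℚ.< r × A ℚ.* r ≡ ½ ℚ.* ε
  scale {A} {ε} 0<A 0<ε = r , 0<r , (begin
      A ℚ.* (½ ℚ.* ε ℚ.* A⁻¹)   ≡⟨ cong (A ℚ.*_) (ℚ.*-comm (½ ℚ.* ε) A⁻¹) ⟩
      A ℚ.* (A⁻¹ ℚ.* (½ ℚ.* ε)) ≡⟨ ℚ.*-assoc A A⁻¹ (½ ℚ.* ε) ⟨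
      A ℚ.* A⁻¹ ℚ.* (½ ℚ.* ε)   ≡⟨ cong (ℚ._* (½ ℚ.* ε)) (ℚ.*-inverseʳ A) ⟩
      1ℚ ℚ.* (½ ℚ.* ε)          ≡⟨ ℚ.*-identityˡ _ ⟩
      ½ ℚ.* ε                   ∎)
    where
    open ≡-Reasoning
    instance
      pos-A = ℚ.positive 0<A
      nonZero-A = ℚ.pos⇒nonZero A
    A⁻¹ = ℚ.1/ A
    r = ½ ℚ.* ε ℚ.* A⁻¹
    0<r : 0ℚ ℚ.< r
    0<r = ℚ.positive⁻¹ r {{ℚ.pos*pos⇒pos (½ ℚ.* ε) {{ℚ.positive (0<½*ε 0<ε)}} A⁻¹ {{ℚ.1/pos⇒pos A}}}}

  ∣pq-rs∣≤ε : ∀ {p q r s A B a b ε} → A ℚ.* a ≡ ½ ℚ.* ε → B ℚ.* b ≡ ½ ℚ.* ε →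
              ℚ.∣ p ∣ ℚ.≤ A → ℚ.∣ s ∣ ℚ.≤ B → ℚ.∣ q ℚ.- s ∣ ℚ.≤ a → ℚ.∣ p ℚ.- r ∣ ℚ.≤ b →
              ℚ.∣ p ℚ.* q ℚ.- r ℚ.* s ∣ ℚ.≤ ε
  ∣pq-rs∣≤ε {p} {q} {r} {s} {A} {B} {a} {b} {ε} Aa Bb hp hs hqs hpr = ℚ.≤-trans
    (∣pq-rs∣≤ p q r s {A} {B} {a} {b} hp hs hqs hpr)
    (subst (A ℚ.* a ℚ.+ B ℚ.* b ℚ.≤_) (halves ε) (ℚ.≤-reflexive (cong₂ ℚ._+_ Aa Bb)))

open RationalEstimates

------------------------------------------------------------------------
-- Real numbers, as Cauchy sequences of rationals

Eventually : (ℕ → Set) → Set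
Eventually P = ∃[ N ] ∀ n → N ℕ.≤ n → P n

IsCauchy : (ℕ → ℚ) → Set
IsCauchy s = ∀ ε → 0ℚ ℚ.< ε →
  ∃[ N ] ∀ m n → N ℕ.≤ m → N ℕ.≤ n → ℚ.∣ s m ℚ.- s n ∣ ℚ.≤ ε

record ℝ : Set where
  no-eta-equality
  field
    seq    : ℕ → ℚ
    cauchy : IsCauchy seq

open ℝ

infix 4 _≈_ _≤_

data _≈_ (x y : ℝ) : Set where
  *≈* : (∀ ε → 0ℚ ℚ.< ε → Eventually λ n → ℚ.∣ seq x n ℚ.- seq y n ∣ ℚ.≤ ε) → x ≈ y

data _≤_ (x y : ℝ) : Set where
  *≤* : (∀ ε → 0ℚ ℚ.< ε → Eventually λ n → seq x n ℚ.≤ seq y n ℚ.+ ε) → x ≤ y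

fromℚ : ℚ → ℝ
fromℚ p .seq _ = p
fromℚ p .cauchy ε 0<ε = 0 , λ _ _ _ _ → p≡q⇒∣p-q∣≤ε {p} refl 0<ε

fromℕ : ℕ → ℝ
fromℕ n = fromℚ (+ n / 1)

0ℝ 1ℝ : ℝ
0ℝ = fromℚ 0ℚ
1ℝ = fromℚ 1ℚ

module CauchyEstimates where

  eventually-∩ : ∀ {P Q R : ℕ → Set} → (∀ {n} → P n → Q n → R n) →
                 Eventually P → Eventually Q → Eventually R
  eventually-∩ f (M , p) (N , q) = M ℕ.⊔ N , λ n h →
    f (p n (ℕ.≤-trans (ℕ.m≤m⊔n M N) h)) (q n (ℕ.≤-trans (ℕ.m≤n⊔m M N) h))

  bounded : ∀ x → ∃[ B ] 0ℚ ℚ.< B × Eventually λ n → ℚ.∣ seq x n ∣ ℚ.≤ B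
  bounded x with cauchy x 1ℚ (ℚ.positive⁻¹ 1ℚ)
  ... | N , c = B , 0<B , N , λ n N≤n → begin
      ℚ.∣ seq x n ∣
        ≡⟨ cong ℚ.∣_∣ (solve 2 (λ p q → p := q :+ (p :- q)) refl (seq x n) (seq x N)) ⟩
      ℚ.∣ seq x N ℚ.+ (seq x n ℚ.- seq x N) ∣
        ≤⟨ ℚ.∣p+q∣≤∣p∣+∣q∣ (seq x N) _ ⟩
      ℚ.∣ seq x N ∣ ℚ.+ ℚ.∣ seq x n ℚ.- seq x N ∣
        ≤⟨ ℚ.+-monoʳ-≤ ℚ.∣ seq x N ∣ (c n N N≤n ℕ.≤-refl) ⟩
      B ∎
    where
    open ℚ.≤-Reasoning
    open +-*-Solver
    B = ℚ.∣ seq x N ∣ ℚ.+ 1ℚ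
    0<B : 0ℚ ℚ.< B
    0<B = ℚ.positive⁻¹ B {{ℚ.nonNeg+pos⇒pos ℚ.∣ seq x N ∣ {{ℚ.∣-∣-nonNeg (seq x N)}} 1ℚ}}

open CauchyEstimates

infix  8 -_
infixl 7 _*_
infixl 6 _+_ _-_

_+_ : ℝ → ℝ → ℝ
(x + y) .seq n = seq x n ℚ.+ seq y n
(x + y) .cauchy ε 0<ε =
  let M , p = cauchy x (½ ℚ.* ε) (0<½*ε 0<ε)
      N , q = cauchy y (½ ℚ.* ε) (0<½*ε 0<ε)
  in M ℕ.⊔ N , λ m n h k → ∣p+q-r-s∣≤ε (seq x m) (seq y m) (seq x n) (seq y n)
    (p m n (ℕ.m⊔n≤o⇒m≤o M N h) (ℕ.m⊔n≤o⇒m≤o M N k))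
    (q m n (ℕ.m⊔n≤o⇒n≤o M N h) (ℕ.m⊔n≤o⇒n≤o M N k))

-_ : ℝ → ℝ
(- x) .seq n = ℚ.- seq x n
(- x) .cauchy ε 0<ε =
  let N , p = cauchy x ε 0<ε
  in N , λ m n h k → ∣-p--q∣≤ε (seq x m) (seq x n) (p m n h k)

_-_ : ℝ → ℝ → ℝ
x - y = x + - y

_*_ : ℝ → ℝ → ℝ
(x * y) .seq n = seq x n ℚ.* seq y n
(x * y) .cauchy ε 0<ε =
  let A , 0<A , K , bx = bounded x
      B , 0<B , L , by = bounded y
      a , 0<a , Aa = scale 0<A 0<ε
      b , 0<b , Bb = scale 0<B 0<ε
      M , q = cauchy y a 0<a
      N , p = cauchy x b 0<b
  in (K ℕ.⊔ L) ℕ.⊔ (M ℕ.⊔ N) , λ m n h k →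
    let h₁ = ℕ.m⊔n≤o⇒m≤o (K ℕ.⊔ L) (M ℕ.⊔ N) h
        h₂ = ℕ.m⊔n≤o⇒n≤o (K ℕ.⊔ L) (M ℕ.⊔ N) h
        k₁ = ℕ.m⊔n≤o⇒m≤o (K ℕ.⊔ L) (M ℕ.⊔ N) k
        k₂ = ℕ.m⊔n≤o⇒n≤o (K ℕ.⊔ L) (M ℕ.⊔ N) k
    in ∣pq-rs∣≤ε {seq x m} {seq y m} {seq x n} {seq y n} Aa Bb
         (bx m (ℕ.m⊔n≤o⇒m≤o K L h₁)) (by n (ℕ.m⊔n≤o⇒n≤o K L k₁))
         (q m n (ℕ.m⊔n≤o⇒m≤o M N h₂) (ℕ.m⊔n≤o⇒m≤o M N k₂))
         (p m n (ℕ.m⊔n≤o⇒n≤o M N h₂) (ℕ.m⊔n≤o⇒n≤o M N k₂))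

≡⇒≈ : ∀ {x y} → (∀ n → seq x n ≡ seq y n) → x ≈ y
≡⇒≈ eq = *≈* λ ε 0<ε → 0 , λ n _ → p≡q⇒∣p-q∣≤ε (eq n) 0<ε

≈-sym : ∀ {x y} → x ≈ y → y ≈ x
≈-sym {x} {y} (*≈* h) = *≈* λ ε 0<ε → let N , p = h ε 0<ε in
  N , λ n k → subst (ℚ._≤ ε) (∣p-q∣≡∣q-p∣ (seq x n) (seq y n)) (p n k)

≈-trans : ∀ {x y z} → x ≈ y → y ≈ z → x ≈ z
≈-trans {x} {y} {z} (*≈* h) (*≈* k) = *≈* λ ε 0<ε → eventually-∩
  (λ {n} p q → ℚ.≤-trans (triangle (seq x n) (seq y n) (seq z n)) (add-halves ε p q))
  (h (½ ℚ.* ε) (0<½*ε 0<ε)) (k (½ ℚ.* ε) (0<½*ε 0<ε))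

+-cong : ∀ {x y u v} → x ≈ y → u ≈ v → x + u ≈ y + v
+-cong {x} {y} {u} {v} (*≈* h) (*≈* k) = *≈* λ ε 0<ε → eventually-∩
  (λ {n} → ∣p+q-r-s∣≤ε (seq x n) (seq u n) (seq y n) (seq v n))
  (h (½ ℚ.* ε) (0<½*ε 0<ε)) (k (½ ℚ.* ε) (0<½*ε 0<ε))

-‿cong : ∀ {x y} → x ≈ y → - x ≈ - y
-‿cong {x} {y} (*≈* h) = *≈* λ ε 0<ε → let N , p = h ε 0<ε in
  N , λ n k → ∣-p--q∣≤ε (seq x n) (seq y n) (p n k)

*-cong : ∀ {x y u v} → x ≈ y → u ≈ v → x * u ≈ y * v
*-cong {x} {y} {u} {v} (*≈* h) (*≈* k) = *≈* close
  where
  close : ∀ ε → 0ℚ ℚ.< ε →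
    Eventually λ n → ℚ.∣ seq x n ℚ.* seq u n ℚ.- seq y n ℚ.* seq v n ∣ ℚ.≤ ε
  close ε 0<ε =
    let A , 0<A , bx = bounded x
        B , 0<B , bv = bounded v
        a , 0<a , Aa = scale 0<A 0<ε
        b , 0<b , Bb = scale 0<B 0<ε
    in eventually-∩
      (λ {n} (p , r) (q , s) → ∣pq-rs∣≤ε {seq x n} {seq u n} {seq y n} {seq v n} Aa Bb p q r s)
      (eventually-∩ _,_ bx (k a 0<a)) (eventually-∩ _,_ bv (h b 0<b))

≈-isEquivalence : IsEquivalence _≈_
≈-isEquivalence = record { refl = ≡⇒≈ λ _ → refl ; sym = ≈-sym ; trans = ≈-trans }

≈-setoid : Setoid 0ℓ 0ℓ
≈-setoid = record { isEquivalence = ≈-isEquivalence }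

+-assoc : ∀ x y z → (x + y) + z ≈ x + (y + z)
+-assoc x y z = ≡⇒≈ λ n → ℚ.+-assoc (seq x n) (seq y n) (seq z n)

+-comm : ∀ x y → x + y ≈ y + x
+-comm x y = ≡⇒≈ λ n → ℚ.+-comm (seq x n) (seq y n)

+-identityˡ : ∀ x → 0ℝ + x ≈ x
+-identityˡ x = ≡⇒≈ λ n → ℚ.+-identityˡ (seq x n)

-‿inverseˡ : ∀ x → (- x) + x ≈ 0ℝ
-‿inverseˡ x = ≡⇒≈ λ n → ℚ.+-inverseˡ (seq x n)

*-assoc : ∀ x y z → (x * y) * z ≈ x * (y * z)
*-assoc x y z = ≡⇒≈ λ n → ℚ.*-assoc (seq x n) (seq y n) (seq z n)

*-comm : ∀ x y → x * y ≈ y * x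
*-comm x y = ≡⇒≈ λ n → ℚ.*-comm (seq x n) (seq y n)

*-identityˡ : ∀ x → 1ℝ * x ≈ x
*-identityˡ x = ≡⇒≈ λ n → ℚ.*-identityˡ (seq x n)

*-distribˡ-+ : ∀ x y z → x * (y + z) ≈ x * y + x * z
*-distribˡ-+ x y z = ≡⇒≈ λ n → ℚ.*-distribˡ-+ (seq x n) (seq y n) (seq z n)

ℝ-commutativeRing : CommutativeRing 0ℓ 0ℓ
ℝ-commutativeRing = record
  { isCommutativeRing = record
    { isRing = record
      { +-isAbelianGroup = record
        { isGroup = record
          { isMonoid = record
            { isSemigroup = record
              { isMagma = record { isEquivalence = ≈-isEquivalence ; ∙-cong = +-cong }
              ; assoc = +-assoc
              }
            ; identity = comm∧idˡ⇒id +-comm +-identityˡ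
            }
          ; inverse = comm∧invˡ⇒inv +-comm -‿inverseˡ
          ; ⁻¹-cong = -‿cong
          }
        ; comm = +-comm
        }
      ; *-cong = *-cong
      ; *-assoc = *-assoc
      ; *-identity = comm∧idˡ⇒id *-comm *-identityˡ
      ; distrib = comm∧distrˡ⇒distr +-cong *-comm *-distribˡ-+
      }
    ; *-comm = *-comm
    }
  }
  where
  open import Algebra.Consequences.Setoid ≈-setoid

module TailEstimates where

  tails⇒cauchy : ∀ {s : ℕ → ℚ} →
    (∀ N m n → N ℕ.< m → N ℕ.< n → s m ℚ.≤ s n ℚ.+ + 1 / suc N) → IsCauchy s
  tails⇒cauchy h ε 0<ε =
    let N , 1/N≤ε = archimedean 0<ε
    in suc N , λ m n p q → ℚ.≤-trans (∣p-q∣≤r (h N m n p q) (h N n m q p)) 1/N≤ε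

  /-distribʳ-+ : ∀ a b p .{{_ : ℕ.NonZero p}} → + (a ℕ.+ b) / p ≡ + a / p ℚ.+ + b / p
  /-distribʳ-+ a b (suc p) = ℚ.toℚᵘ-injective (begin
    ℚ.toℚᵘ (+ (a ℕ.+ b) / suc p)                     ≈⟨ ℚ.toℚᵘ-fromℚᵘ (mk (a ℕ.+ b)) ⟩
    mk (a ℕ.+ b)                                      ≈⟨ ℚᵘ.*≡* (same-denominator (+ a) (+ b) (+ suc p)) ⟩
    mk a ℚᵘ.+ mk b                                    ≈⟨ ℚᵘ.+-cong (ℚ.toℚᵘ-fromℚᵘ (mk a)) (ℚ.toℚᵘ-fromℚᵘ (mk b)) ⟨
    ℚ.toℚᵘ (+ a / suc p) ℚᵘ.+ ℚ.toℚᵘ (+ b / suc p) ≈⟨ ℚ.toℚᵘ-homo-+ (+ a / suc p) (+ b / suc p) ⟨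
    ℚ.toℚᵘ (+ a / suc p ℚ.+ + b / suc p)            ∎)
    where
    open ℚᵘ.≃-Reasoning
    mk : ℕ → ℚᵘ.ℚᵘ
    mk a = ℚᵘ.mkℚᵘ (+ a) p
    same-denominator : ∀ i j k → (i ℤ.+ j) ℤ.* (k ℤ.* k) ≡ (i ℤ.* k ℤ.+ j ℤ.* k) ℤ.* k
    same-denominator = solve-∀

open TailEstimates

1/_! : ℕ → ℚ
1/ n ! = (+ 1 / n !) {{n ℕ.!≢0}}

∑1/i! : ℕ → ℚ
∑1/i! zero    = 1/ 0 !
∑1/i! (suc m) = ∑1/i! m ℚ.+ 1/ suc m !

module FactorialEstimates where

  1/n!≤1/n : ∀ n → 1/ suc n ! ℚ.≤ + 1 / suc n
  1/n!≤1/n n = /-mono-≤ 1 (suc n !) 1 (suc n) {{suc n ℕ.!≢0}}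
    (subst₂ ℕ._≤_ (sym (ℕ.*-identityˡ (suc n))) (sym (ℕ.*-identityˡ (suc n !)))
      (ℕ.m≤m*n (suc n) (n !) {{n ℕ.!≢0}}))

  1/-1/-≤ : ∀ n → 1/ 2 ℕ.+ n ! ℚ.+ 1/ 2 ℕ.+ n ! ℚ.≤ 1/ 1 ℕ.+ n !
  1/-1/-≤ n = subst (ℚ._≤ 1/ suc n !)
    (/-distribʳ-+ 1 1 ((2 ℕ.+ n) !) {{(2 ℕ.+ n) ℕ.!≢0}})
    (/-mono-≤ 2 ((2 ℕ.+ n) !) 1 (suc n !) {{(2 ℕ.+ n) ℕ.!≢0}} {{suc n ℕ.!≢0}}
      (subst (2 ℕ.* suc n ! ℕ.≤_) (sym (ℕ.*-identityˡ ((2 ℕ.+ n) !)))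
        (ℕ.*-monoˡ-≤ (suc n !) (ℕ.s≤s (ℕ.s≤s (ℕ.z≤n {n}))))))

  0≤1/n! : ∀ n → 0ℚ ℚ.≤ 1/ n !
  0≤1/n! n = /-mono-≤ 0 1 1 (n !) {{_}} {{n ℕ.!≢0}} ℕ.z≤n

  ∑-step : ∀ m → ∑1/i! m ℚ.≤ ∑1/i! (suc m)
  ∑-step m = subst (ℚ._≤ ∑1/i! (suc m)) (ℚ.+-identityʳ (∑1/i! m))
    (ℚ.+-monoʳ-≤ (∑1/i! m) (0≤1/n! (suc m)))

  ∑-mono : ∀ {m n} → m ℕ.≤′ n → ∑1/i! m ℚ.≤ ∑1/i! n
  ∑-mono ℕ.≤′-refl     = ℚ.≤-refl
  ∑-mono (ℕ.≤′-step {n} h) = ℚ.≤-trans (∑-mono h) (∑-step n)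

  ∑-upper : ∀ {n m} → suc n ℕ.≤′ m → ∑1/i! m ℚ.+ 1/ m ! ℚ.≤ ∑1/i! (suc n) ℚ.+ 1/ suc n !
  ∑-upper ℕ.≤′-refl = ℚ.≤-refl
  ∑-upper {n} (ℕ.≤′-step {m} h) = ℚ.≤-trans (step m (ℕ.≤′⇒≤ h)) (∑-upper h)
    where
    step : ∀ m → suc n ℕ.≤ m → ∑1/i! (suc m) ℚ.+ 1/ suc m ! ℚ.≤ ∑1/i! m ℚ.+ 1/ m !
    step (suc m) _ = subst (ℚ._≤ ∑1/i! (suc m) ℚ.+ 1/ suc m !)
      (sym (ℚ.+-assoc (∑1/i! (suc m)) _ _))
      (ℚ.+-monoʳ-≤ (∑1/i! (suc m)) (1/-1/-≤ m))

open FactorialEstimates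

e : ℝ
e .seq    = ∑1/i!
e .cauchy = tails⇒cauchy λ N m n N<m N<n → begin
  ∑1/i! m                       ≡⟨ ℚ.+-identityʳ (∑1/i! m) ⟨
  ∑1/i! m ℚ.+ 0ℚ               ≤⟨ ℚ.+-monoʳ-≤ (∑1/i! m) (0≤1/n! m) ⟩
  ∑1/i! m ℚ.+ 1/ m !           ≤⟨ ∑-upper (ℕ.≤⇒≤′ N<m) ⟩
  ∑1/i! (suc N) ℚ.+ 1/ suc N ! ≤⟨ ℚ.+-mono-≤ (∑-mono (ℕ.≤⇒≤′ N<n)) (1/n!≤1/n N) ⟩
  ∑1/i! n ℚ.+ + 1 / suc N      ∎
  where
  open ℚ.≤-Reasoning

module LogarithmEstimates where

  n<2^[1+⌊log₂n⌋] : ∀ n → n ℕ.< 2 ℕ.^ suc ⌊log₂ n ⌋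
  n<2^[1+⌊log₂n⌋] n = ℕ.≰⇒> λ h → ℕ.<-irrefl refl
    (subst (ℕ._≤ ⌊log₂ n ⌋) (⌊log₂[2^n]⌋≡n (suc ⌊log₂ n ⌋)) (⌊log₂⌋-mono-≤ h))

  2^⌊log₂n⌋≤n : ∀ n → 1 ℕ.≤ n → 2 ℕ.^ ⌊log₂ n ⌋ ℕ.≤ n
  2^⌊log₂n⌋≤n = <-rec (λ n → 1 ℕ.≤ n → 2 ℕ.^ ⌊log₂ n ⌋ ℕ.≤ n) step
    where
    open ℕ.≤-Reasoning
    step : ∀ n → (∀ {m} → m ℕ.< n → 1 ℕ.≤ m → 2 ℕ.^ ⌊log₂ m ⌋ ℕ.≤ m) →
           1 ℕ.≤ n → 2 ℕ.^ ⌊log₂ n ⌋ ℕ.≤ n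
    step 1 rec _ = ℕ.≤-refl
    step n@(suc (suc k)) rec _ = begin
      2 ℕ.^ ⌊log₂ n ⌋                  ≤⟨ ℕ.^-monoʳ-≤ 2 (ℕ.m≤n+m∸n ⌊log₂ n ⌋ 1) ⟩
      2 ℕ.^ suc (⌊log₂ n ⌋ ℕ.∸ 1)     ≡⟨ cong (λ l → 2 ℕ.^ suc l) (⌊log₂⌊n/2⌋⌋≡⌊log₂n⌋∸1 n) ⟨
      2 ℕ.* 2 ℕ.^ ⌊log₂ ℕ.⌊ n /2⌋ ⌋  ≤⟨ ℕ.*-monoʳ-≤ 2 (rec (ℕ.⌊n/2⌋<n (suc k)) (ℕ.s≤s ℕ.z≤n)) ⟩
      2 ℕ.* ℕ.⌊ n /2⌋                  ≡⟨ cong (ℕ.⌊ n /2⌋ ℕ.+_) (ℕ.+-identityʳ ℕ.⌊ n /2⌋) ⟩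
      ℕ.⌊ n /2⌋ ℕ.+ ℕ.⌊ n /2⌋        ≤⟨ ℕ.+-monoʳ-≤ ℕ.⌊ n /2⌋ (ℕ.⌊n/2⌋≤⌈n/2⌉ n) ⟩
      ℕ.⌊ n /2⌋ ℕ.+ ℕ.⌈ n /2⌉        ≡⟨ ℕ.⌊n/2⌋+⌈n/2⌉≡n n ⟩
      n                                 ∎

  ⌊log₂n^p⌋*q≤ : ∀ n p q → ⌊log₂ n ℕ.^ suc p ⌋ ℕ.* suc q ℕ.≤ (⌊log₂ n ℕ.^ suc q ⌋ ℕ.+ 1) ℕ.* suc p
  ⌊log₂n^p⌋*q≤ zero       p q = ℕ.z≤n
  ⌊log₂n^p⌋*q≤ n@(suc _) p q = ℕ.≮⇒≥ λ h → ℕ.<-irrefl refl (begin-strict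
    n ℕ.^ (suc q ℕ.* suc p)                ≡⟨ ℕ.^-*-assoc n (suc q) (suc p) ⟨
    (n ℕ.^ suc q) ℕ.^ suc p                <⟨ ℕ.^-monoˡ-< (suc p) (n<2^[1+⌊log₂n⌋] (n ℕ.^ suc q)) ⟩
    (2 ℕ.^ suc b) ℕ.^ suc p                ≡⟨ ℕ.^-*-assoc 2 (suc b) (suc p) ⟩
    2 ℕ.^ (suc b ℕ.* suc p)                ≡⟨ cong (λ c → 2 ℕ.^ (c ℕ.* suc p)) (ℕ.+-comm 1 b) ⟩
    2 ℕ.^ ((b ℕ.+ 1) ℕ.* suc p)           ≤⟨ ℕ.^-monoʳ-≤ 2 (ℕ.<⇒≤ h) ⟩
    2 ℕ.^ (a ℕ.* suc q)                    ≡⟨ ℕ.^-*-assoc 2 a (suc q) ⟨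
    (2 ℕ.^ a) ℕ.^ suc q                    ≤⟨ ℕ.^-monoˡ-≤ (suc q) (2^⌊log₂n⌋≤n (n ℕ.^ suc p) (ℕ.m^n>0 n (suc p))) ⟩
    (n ℕ.^ suc p) ℕ.^ suc q                ≡⟨ ℕ.^-*-assoc n (suc p) (suc q) ⟩
    n ℕ.^ (suc p ℕ.* suc q)                ≡⟨ cong (n ℕ.^_) (ℕ.*-comm (suc p) (suc q)) ⟩
    n ℕ.^ (suc q ℕ.* suc p)                ∎)
    where
    open ℕ.≤-Reasoning
    a = ⌊log₂ n ℕ.^ suc p ⌋
    b = ⌊log₂ n ℕ.^ suc q ⌋

open LogarithmEstimates

-- log₂ n = lim ⌊log₂ (n ^ m)⌋ / m; the value log₂ 0 = 0 is junk.

log₂ : ℕ → ℝ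
log₂ n .seq m  = + ⌊log₂ n ℕ.^ suc m ⌋ / suc m
log₂ n .cauchy = tails⇒cauchy λ N p q N<p N<q → begin
  + a p / suc p                         ≤⟨ /-mono-≤ (a p) (suc p) (a q ℕ.+ 1) (suc q) (⌊log₂n^p⌋*q≤ n p q) ⟩
  + (a q ℕ.+ 1) / suc q                 ≡⟨ /-distribʳ-+ (a q) 1 (suc q) ⟩
  + a q / suc q ℚ.+ + 1 / suc q         ≤⟨ ℚ.+-monoʳ-≤ (+ a q / suc q)
                                             (/-mono-≤ 1 (suc q) 1 (suc N)
                                               (ℕ.*-monoʳ-≤ 1 (ℕ.<⇒≤ (ℕ.s≤s N<q)))) ⟩
  + a q / suc q ℚ.+ + 1 / suc N         ∎
  where
  open ℚ.≤-Reasoning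
  a : ℕ → ℕ
  a m = ⌊log₂ n ℕ.^ suc m ⌋

infix 4 _⟶0

_⟶0 : (ℕ → ℝ) → Set
δ ⟶0 = ∀ ε → 0ℚ ℚ.< ε → Eventually λ n → (- fromℚ ε ≤ δ n) × (δ n ≤ fromℚ ε)

------------------------------------------------------------------------
-- Real polynomials

-- The free commutative ℝ-algebra on the set of variables V: expressions,
-- up to the equality generated by the commutative ring laws and by con being
-- a ring homomorphism.

infix  8 -ᵖ_
infixl 7 _*ᵖ_
infixl 6 _+ᵖ_ _-ᵖ_

data Poly (V : Set) : Set where
  con       : ℝ → Poly V
  var       : V → Poly V
  _+ᵖ_ _*ᵖ_ : Poly V → Poly V → Poly V
  -ᵖ_       : Poly V → Poly V

0ᵖ 1ᵖ : ∀ {V} → Poly V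
0ᵖ = con 0ℝ
1ᵖ = con 1ℝ

_-ᵖ_ : ∀ {V} → Poly V → Poly V → Poly V
p -ᵖ q = p +ᵖ -ᵖ q

infix 4 _≈ᵖ_

data _≈ᵖ_ {V : Set} : Poly V → Poly V → Set where
  ≈ᵖ-refl     : ∀ {p} → p ≈ᵖ p
  ≈ᵖ-sym      : ∀ {p q} → p ≈ᵖ q → q ≈ᵖ p
  ≈ᵖ-trans    : ∀ {p q r} → p ≈ᵖ q → q ≈ᵖ r → p ≈ᵖ r
  +ᵖ-cong     : ∀ {p q r s} → p ≈ᵖ q → r ≈ᵖ s → p +ᵖ r ≈ᵖ q +ᵖ s
  *ᵖ-cong     : ∀ {p q r s} → p ≈ᵖ q → r ≈ᵖ s → p *ᵖ r ≈ᵖ q *ᵖ s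
  -ᵖ-cong     : ∀ {p q} → p ≈ᵖ q → -ᵖ p ≈ᵖ -ᵖ q
  +ᵖ-assoc    : ∀ p q r → (p +ᵖ q) +ᵖ r ≈ᵖ p +ᵖ (q +ᵖ r)
  +ᵖ-comm     : ∀ p q → p +ᵖ q ≈ᵖ q +ᵖ p
  +ᵖ-identity : ∀ p → 0ᵖ +ᵖ p ≈ᵖ p
  +ᵖ-inverse  : ∀ p → -ᵖ p +ᵖ p ≈ᵖ 0ᵖ
  *ᵖ-assoc    : ∀ p q r → (p *ᵖ q) *ᵖ r ≈ᵖ p *ᵖ (q *ᵖ r)
  *ᵖ-comm     : ∀ p q → p *ᵖ q ≈ᵖ q *ᵖ p
  *ᵖ-identity : ∀ p → 1ᵖ *ᵖ p ≈ᵖ p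
  *ᵖ-distrib  : ∀ p q r → p *ᵖ (q +ᵖ r) ≈ᵖ p *ᵖ q +ᵖ p *ᵖ r
  con-cong    : ∀ {a b} → a ≈ b → con a ≈ᵖ con b
  con-+       : ∀ a b → con (a + b) ≈ᵖ con a +ᵖ con b
  con-*       : ∀ a b → con (a * b) ≈ᵖ con a *ᵖ con b

≈ᵖ-isEquivalence : ∀ {V} → IsEquivalence (_≈ᵖ_ {V})
≈ᵖ-isEquivalence = record { refl = ≈ᵖ-refl ; sym = ≈ᵖ-sym ; trans = ≈ᵖ-trans }

≈ᵖ-setoid : Set → Setoid 0ℓ 0ℓ
≈ᵖ-setoid V = record { isEquivalence = ≈ᵖ-isEquivalence {V} }

polynomialRing : Set → CommutativeRing 0ℓ 0ℓ
polynomialRing V = record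
  { Carrier = Poly V ; _≈_ = _≈ᵖ_ ; _+_ = _+ᵖ_ ; _*_ = _*ᵖ_ ; -_ = -ᵖ_ ; 0# = 0ᵖ ; 1# = 1ᵖ
  ; isCommutativeRing = record
    { isRing = record
      { +-isAbelianGroup = record
        { isGroup = record
          { isMonoid = record
            { isSemigroup = record
              { isMagma = record { isEquivalence = ≈ᵖ-isEquivalence ; ∙-cong = +ᵖ-cong }
              ; assoc = +ᵖ-assoc
              }
            ; identity = comm∧idˡ⇒id +ᵖ-comm +ᵖ-identity
            }
          ; inverse = comm∧invˡ⇒inv +ᵖ-comm +ᵖ-inverse
          ; ⁻¹-cong = -ᵖ-cong
          }
        ; comm = +ᵖ-comm
        }
      ; *-cong = *ᵖ-cong
      ; *-assoc = *ᵖ-assoc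
      ; *-identity = comm∧idˡ⇒id *ᵖ-comm *ᵖ-identity
      ; distrib = comm∧distrˡ⇒distr +ᵖ-cong *ᵖ-comm *ᵖ-distrib
      }
    ; *-comm = *ᵖ-comm
    }
  }
  where
  open import Algebra.Consequences.Setoid (≈ᵖ-setoid V)

module _ {V : Set} where
  open MonoidSum (CommutativeRing.+-commutativeMonoid (polynomialRing V)) public
    using () renaming (sum to ∑ᵖ)

formalDegree : ∀ {V} → Poly V → ℕ
formalDegree (con _)  = 0
formalDegree (var _)  = 1
formalDegree (p +ᵖ q) = formalDegree p ℕ.⊔ formalDegree q
formalDegree (p *ᵖ q) = formalDegree p ℕ.+ formalDegree q
formalDegree (-ᵖ p)   = formalDegree p

-- The formal degree depends on the expression and can only overestimate the
-- degree; a polynomial has degree at most d when it is 0 (of degree -∞) or some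
-- expression for it has formal degree at most d.

Degree≤ : ∀ {V} → ℝ → Poly V → Set
Degree≤ d p = p ≈ᵖ 0ᵖ ⊎ ∃[ q ] p ≈ᵖ q × fromℕ (formalDegree q) ≤ d

------------------------------------------------------------------------
-- The random graph G(n, 1/2)

-- A graph on Fin (suc n) is a graph on the vertices suc i together with the
-- neighbourhood of the vertex zero; so each pair of vertices has one bit.

data Graph : ℕ → Set where
  ∅   : Graph 0
  _▷_ : ∀ {n} → Graph n → Vec Bool n → Graph (suc n)

adjacent : ∀ {n} → Graph n → Fin n → Fin n → Bool
adjacent (G ▷ N) Fin.zero    Fin.zero    = false
adjacent (G ▷ N) Fin.zero    (Fin.suc j) = lookup N j
adjacent (G ▷ N) (Fin.suc i) Fin.zero    = lookup N i
adjacent (G ▷ N) (Fin.suc i) (Fin.suc j) = adjacent G i j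

-- Expectations over one fair bit, over n independent fair bits, and over a
-- graph whose bits are independent and fair.

𝔼-bit : (Bool → ℚ) → ℚ
𝔼-bit f = ½ ℚ.* f true ℚ.+ ½ ℚ.* f false

𝔼-bits : ∀ n → (Vec Bool n → ℚ) → ℚ
𝔼-bits zero    f = f []
𝔼-bits (suc n) f = 𝔼-bit λ b → 𝔼-bits n λ bs → f (b ∷ bs)

𝔼-graph : ∀ n → (Graph n → ℚ) → ℚ
𝔼-graph zero    f = f ∅
𝔼-graph (suc n) f = 𝔼-graph n λ G → 𝔼-bits n λ N → f (G ▷ N)

-- An event need not be decidable; its probability is at least q when it
-- contains a decidable event of probability at least q.

Pr≥ : ∀ n → (Graph n → Set) → ℚ → Set
Pr≥ n A q = Σ (Graph n → Bool) λ B →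
  (∀ G → T (B G) → A G) × q ℚ.≤ 𝔼-graph n (λ G → if B G then 1ℚ else 0ℚ)

WithHighProbability : (∀ n → Graph n → Set) → Set
WithHighProbability A = ∀ ε → 0ℚ ℚ.< ε → Eventually λ n → Pr≥ n (A n) (1ℚ ℚ.- ε)

------------------------------------------------------------------------
-- Coloring pseudo-expectations

-- The hypotheses h are membership proofs for the domain of 𝔼̃; they follow from
-- the bound on the degree of f, and by 𝔼̃-cong the value does not depend on them.

record ColoringPseudoExpectation (d : ℝ) {n : ℕ} (G : Graph n) (k : ℕ) : Set where

  Polynomial : Set
  Polynomial = Poly (Fin n × Fin k)

  x : Fin n → Fin k → Polynomial
  x i c = var (i , c)

  field
    𝔼̃       : (f : Polynomial) → Degree≤ d f → ℝ
    𝔼̃-cong  : ∀ {f g} hf hg → f ≈ᵖ g → 𝔼̃ f hf ≈ 𝔼̃ g hg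
    𝔼̃-+     : ∀ f g hf hg h → 𝔼̃ (f +ᵖ g) h ≈ 𝔼̃ f hf + 𝔼̃ g hg
    𝔼̃-scale : ∀ a f hf h → 𝔼̃ (con a *ᵖ f) h ≈ a * 𝔼̃ f hf

    𝔼̃-one : Σ (Degree≤ d 1ᵖ) λ h → 𝔼̃ 1ᵖ h ≈ 1ℝ

    𝔼̃-square : ∀ f → Degree≤ (fromℚ ½ * d) f →
      ∀ h → 0ℝ ≤ 𝔼̃ (f *ᵖ f) h

    𝔼̃-boolean : ∀ f → Degree≤ (d - fromℕ 2) f → ∀ i c →
      ∀ h → 𝔼̃ (f *ᵖ (x i c *ᵖ x i c -ᵖ x i c)) h ≈ 0ℝ

    𝔼̃-edge : ∀ f → Degree≤ (d - fromℕ 2) f → ∀ i j → T (adjacent G i j) → ∀ c →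
      ∀ h → 𝔼̃ (f *ᵖ (x i c *ᵖ x j c)) h ≈ 0ℝ

    𝔼̃-colored : ∀ f → Degree≤ (fromℚ ½ * (d - 1ℝ)) f → ∀ i →
      ∀ h → 0ℝ ≤ 𝔼̃ (f *ᵖ f *ᵖ (∑ᵖ (x i) -ᵖ 1ᵖ)) h

{-# OPTIONS --safe #-}
module Submission where

-- Both sequences can be taken to be 0. With high probability G has no
-- independent set of size r = 2 ⌊log₂ n⌋ + 5, by the first moment method. Let S
-- be the size of a color class, U = S - r, and x_I the product of the variables
-- of that class over a vertex set I. Downward induction on |I| shows
-- 𝔼̃[x_I² U] ≤ 0: if |I| = r then I contains an edge, and if |I| < r then
--   r 𝔼̃[x_I² U] ≤ 𝔼̃[(x_I U)²] + r 𝔼̃[x_I² U] = ∑ᵢ 𝔼̃[x_I² xᵢ U] ≤ |I| 𝔼̃[x_I² U],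
-- since the i-th term is 𝔼̃[x_I² U] for i ∈ I and 𝔼̃[x_{I∪i}² U] ≤ 0 for i ∉ I.
-- For I = ∅ this is 𝔼̃[S] ≤ r, and summing the coloring constraints gives
-- n ≤ k r, which contradicts k · 4 ⌊log₂ n⌋ ≤ n (from e ≥ 2) once n ≥ 16.

open import Defs
open import Algebra.Bundles using (CommutativeRing)
import Algebra.Properties.Semiring.Sum as SemiringSum
import Algebra.Solver.Ring.NaturalCoefficients.Default as SemiringSolver
open import Data.Bool using (Bool; true; false; T; _∧_; if_then_else_)
open import Data.Fin as Fin using (Fin)
open import Data.Fin.Subset using (Subset; inside; outside; ∣_∣; ⊥)
open import Data.Fin.Subset.Properties using (∣⊥∣≡0)
open import Data.Integer using (+_)
open import Data.Nat as ℕ using (ℕ; zero; suc)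
open import Data.Nat.Logarithm using (⌊log₂_⌋; ⌊log₂⌋-mono-≤; ⌊log₂[2^n]⌋≡n)
import Data.Nat.Properties as ℕ
open import Data.Nat.Tactic.RingSolver using (solve-∀)
open import Data.Product using (Σ; ∃-syntax; _×_; _,_)
open import Data.Rational as ℚ using (ℚ; 0ℚ; 1ℚ; ½; _/_)
import Data.Rational.Properties as ℚ
open import Data.Rational.Solver using (module +-*-Solver)
import Data.Rational.Unnormalised as ℚᵘ
import Data.Rational.Unnormalised.Properties as ℚᵘ
open import Data.Sum using (inj₁; inj₂)
open import Data.Unit using (tt)
open import Data.Vec using (Vec; []; _∷_; lookup; _[_]≔_)
open import Data.Vec.Properties using (lookup∘update′)
open import Function using (_∘_)
open import Level using (0ℓ)
open import Relation.Binary.Bundles using (Preorder)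
open import Relation.Binary.PropositionalEquality
open import Relation.Nullary using (¬_; yes; no; contradiction)
open import Relation.Nullary.Decidable using (⌊_⌋; toWitness)

open CauchyEstimates
open FactorialEstimates using (∑-mono)
open LogarithmEstimates
open RationalEstimates
open TailEstimates
open ℝ

-- Natural numbers in ℚ and powers of one half.

ι : ℕ → ℚ
ι n = + n / 1

ι-+ : ∀ m n → ι (m ℕ.+ n) ≡ ι m ℚ.+ ι n
ι-+ m n = /-distribʳ-+ m n 1

ι-* : ∀ m n → ι (m ℕ.* n) ≡ ι m ℚ.* ι n
ι-* zero    n = sym (ℚ.*-zeroˡ (ι n))
ι-* (suc m) n = begin
  ι (n ℕ.+ m ℕ.* n)       ≡⟨ ι-+ n (m ℕ.* n) ⟩
  ι n ℚ.+ ι (m ℕ.* n)     ≡⟨ cong (ι n ℚ.+_) (ι-* m n) ⟩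
  ι n ℚ.+ ι m ℚ.* ι n     ≡⟨ cong (ℚ._+ ι m ℚ.* ι n) (ℚ.*-identityˡ (ι n)) ⟨
  1ℚ ℚ.* ι n ℚ.+ ι m ℚ.* ι n ≡⟨ ℚ.*-distribʳ-+ (ι n) 1ℚ (ι m) ⟨
  (1ℚ ℚ.+ ι m) ℚ.* ι n    ≡⟨ cong (ℚ._* ι n) (ι-+ 1 m) ⟨
  ι (suc m) ℚ.* ι n       ∎
  where open ≡-Reasoning

ι-mono-≤ : ∀ {m n} → m ℕ.≤ n → ι m ℚ.≤ ι n
ι-mono-≤ {m} {n} h = /-mono-≤ m 1 n 1 (ℕ.*-monoˡ-≤ 1 h)

0≤ι : ∀ n → 0ℚ ℚ.≤ ι n
0≤ι n = ι-mono-≤ {0} {n} ℕ.z≤n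

*-mono-≤-nonNeg : ∀ {p q r s} → 0ℚ ℚ.≤ p → p ℚ.≤ q → 0ℚ ℚ.≤ r → r ℚ.≤ s → p ℚ.* r ℚ.≤ q ℚ.* s
*-mono-≤-nonNeg {p} {q} {r} {s} 0≤p p≤q 0≤r r≤s = ℚ.≤-trans
  (ℚ.*-monoʳ-≤-nonNeg r {{ℚ.nonNegative 0≤r}} p≤q)
  (ℚ.*-monoˡ-≤-nonNeg q {{ℚ.nonNegative (ℚ.≤-trans 0≤p p≤q)}} r≤s)

*-nonNeg : ∀ {p q} → 0ℚ ℚ.≤ p → 0ℚ ℚ.≤ q → 0ℚ ℚ.≤ p ℚ.* q
*-nonNeg {p} {q} 0≤p 0≤q = subst (ℚ._≤ p ℚ.* q) (ℚ.*-zeroˡ 0ℚ)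
  (*-mono-≤-nonNeg ℚ.≤-refl 0≤p ℚ.≤-refl 0≤q)

½^_ : ℕ → ℚ
½^ zero  = 1ℚ
½^ suc n = ½ ℚ.* ½^ n

0≤½^ : ∀ n → 0ℚ ℚ.≤ ½^ n
0≤½^ zero    = ℚ.nonNegative⁻¹ 1ℚ
0≤½^ (suc n) = *-nonNeg (ℚ.nonNegative⁻¹ ½) (0≤½^ n)

½^-+ : ∀ m n → ½^ (m ℕ.+ n) ≡ ½^ m ℚ.* ½^ n
½^-+ zero    n = sym (ℚ.*-identityˡ (½^ n))
½^-+ (suc m) n = trans (cong (½ ℚ.*_) (½^-+ m n)) (sym (ℚ.*-assoc ½ (½^ m) (½^ n)))

2^n*½^n≡1 : ∀ n → ι (2 ℕ.^ n) ℚ.* ½^ n ≡ 1ℚ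
2^n*½^n≡1 zero    = refl
2^n*½^n≡1 (suc n) = begin
  ι (2 ℕ.* 2 ℕ.^ n) ℚ.* (½ ℚ.* ½^ n)      ≡⟨ cong (ℚ._* (½ ℚ.* ½^ n)) (ι-* 2 (2 ℕ.^ n)) ⟩
  (ι 2 ℚ.* ι (2 ℕ.^ n)) ℚ.* (½ ℚ.* ½^ n)  ≡⟨ interchange (ι 2) (ι (2 ℕ.^ n)) ½ (½^ n) ⟩
  (ι 2 ℚ.* ½) ℚ.* (ι (2 ℕ.^ n) ℚ.* ½^ n)  ≡⟨ cong (1ℚ ℚ.*_) (2^n*½^n≡1 n) ⟩
  1ℚ                                        ∎
  where
  open ≡-Reasoning
  open +-*-Solver
  interchange : ∀ a b c d → (a ℚ.* b) ℚ.* (c ℚ.* d) ≡ (a ℚ.* c) ℚ.* (b ℚ.* d)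
  interchange = solve 4 (λ a b c d → (a :* b) :* (c :* d) := (a :* c) :* (b :* d)) refl

-- The division-free form of n / 2^m ≤ 1. It serves both to bound the first moment and to make
-- powers of one half small.
n*½^m≤1 : ∀ {n m} → n ℕ.≤ 2 ℕ.^ m → ι n ℚ.* ½^ m ℚ.≤ 1ℚ
n*½^m≤1 {n} {m} h = subst (ι n ℚ.* ½^ m ℚ.≤_) (2^n*½^n≡1 m)
  (ℚ.*-monoʳ-≤-nonNeg (½^ m) {{ℚ.nonNegative (0≤½^ m)}} (ι-mono-≤ h))

-- Expectations

𝟙 : Bool → ℚ
𝟙 b = if b then 1ℚ else 0ℚ

0≤𝟙 : ∀ b → 0ℚ ℚ.≤ 𝟙 b
0≤𝟙 true  = ℚ.nonNegative⁻¹ 1ℚ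
0≤𝟙 false = ℚ.≤-refl

𝟙-∧ : ∀ a b → 𝟙 (a ∧ b) ≡ 𝟙 a ℚ.* 𝟙 b
𝟙-∧ true  b = sym (ℚ.*-identityˡ (𝟙 b))
𝟙-∧ false b = sym (ℚ.*-zeroˡ (𝟙 b))

-- `𝔼-bits` and `𝔼-graph` are nested averages. These laws survive nesting, as `iterated` shows with
-- `pair` being `_∷_` or `_▷_`.
record IsExpectation {Ω : Set} (𝔼 : (Ω → ℚ) → ℚ) : Set where
  field
    𝔼-mono  : ∀ {f g} → (∀ ω → f ω ℚ.≤ g ω) → 𝔼 f ℚ.≤ 𝔼 g
    𝔼-+     : ∀ f g → 𝔼 (λ ω → f ω ℚ.+ g ω) ≡ 𝔼 f ℚ.+ 𝔼 g
    𝔼-*     : ∀ a f → 𝔼 (λ ω → a ℚ.* f ω) ≡ a ℚ.* 𝔼 f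
    𝔼-const : ∀ a → 𝔼 (λ _ → a) ≡ a

  𝔼-cong : ∀ {f g} → (∀ ω → f ω ≡ g ω) → 𝔼 f ≡ 𝔼 g
  -- Monotonicity in both directions takes the place of function extensionality.
  𝔼-cong eq = ℚ.≤-antisym (𝔼-mono (ℚ.≤-reflexive ∘ eq)) (𝔼-mono (ℚ.≤-reflexive ∘ sym ∘ eq))

open IsExpectation

module _ {Ω Ω′ Ω″ : Set} {𝔼₁ : (Ω → ℚ) → ℚ} {𝔼₂ : (Ω′ → ℚ) → ℚ}
         (E₁ : IsExpectation 𝔼₁) (E₂ : IsExpectation 𝔼₂) (pair : Ω → Ω′ → Ω″) where

  iterated : IsExpectation (λ f → 𝔼₁ λ ω → 𝔼₂ λ ω′ → f (pair ω ω′))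
  iterated .𝔼-mono h      = 𝔼-mono E₁ λ ω → 𝔼-mono E₂ λ ω′ → h (pair ω ω′)
  iterated .𝔼-+ f g       = trans (𝔼-cong E₁ λ ω → 𝔼-+ E₂ (f ∘ pair ω) (g ∘ pair ω)) (𝔼-+ E₁ _ _)
  iterated .𝔼-* a f       = trans (𝔼-cong E₁ λ ω → 𝔼-* E₂ a (f ∘ pair ω)) (𝔼-* E₁ a _)
  iterated .𝔼-const a     = trans (𝔼-cong E₁ λ ω → 𝔼-const E₂ a) (𝔼-const E₁ a)

pointMass : ∀ {Ω : Set} (ω : Ω) → IsExpectation (λ f → f ω)
pointMass ω .𝔼-mono h  = h ω
pointMass ω .𝔼-+ f g   = refl
pointMass ω .𝔼-* a f   = refl
pointMass ω .𝔼-const a = refl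

𝔼-bit-isExpectation : IsExpectation 𝔼-bit
𝔼-bit-isExpectation .𝔼-mono h = ℚ.+-mono-≤
  (ℚ.*-monoˡ-≤-nonNeg ½ (h true)) (ℚ.*-monoˡ-≤-nonNeg ½ (h false))
𝔼-bit-isExpectation .𝔼-+ f g =
  solve 5 (λ h a b c d → h :* (a :+ c) :+ h :* (b :+ d) := (h :* a :+ h :* b) :+ (h :* c :+ h :* d))
    refl ½ (f true) (f false) (g true) (g false)
  where open +-*-Solver
𝔼-bit-isExpectation .𝔼-* a f =
  solve 4 (λ h a b c → h :* (a :* b) :+ h :* (a :* c) := a :* (h :* b :+ h :* c))
    refl ½ a (f true) (f false)
  where open +-*-Solver
𝔼-bit-isExpectation .𝔼-const a = halves a

𝔼-bits-isExpectation : ∀ n → IsExpectation (𝔼-bits n)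
𝔼-bits-isExpectation zero    = pointMass []
𝔼-bits-isExpectation (suc n) = iterated 𝔼-bit-isExpectation (𝔼-bits-isExpectation n) _∷_

𝔼-graph-isExpectation : ∀ n → IsExpectation (𝔼-graph n)
𝔼-graph-isExpectation zero    = pointMass ∅
𝔼-graph-isExpectation (suc n) = iterated (𝔼-graph-isExpectation n) (𝔼-bits-isExpectation n) _▷_

-- Independent sets

disjoint : ∀ {n} → Vec Bool n → Subset n → Bool
disjoint []          []            = true
disjoint (b ∷ N)     (outside ∷ I) = disjoint N I
disjoint (true ∷ N)  (inside ∷ I)  = false
disjoint (false ∷ N) (inside ∷ I)  = disjoint N I

-- The recursion follows `Graph`: if vertex zero is in the set, its neighbourhood has to avoid the
-- other members. Every bit is inspected at most once, so the probability factors.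
independent : ∀ {n} → Graph n → Subset n → Bool
independent ∅       []            = true
independent (G ▷ N) (outside ∷ I) = independent G I
independent (G ▷ N) (inside ∷ I)  = independent G I ∧ disjoint N I

Pr[disjoint] : ∀ {n} (I : Subset n) → 𝔼-bits n (λ N → 𝟙 (disjoint N I)) ≡ ½^ ∣ I ∣
Pr[disjoint] [] = refl
Pr[disjoint] (outside ∷ I) = trans (halves _) (Pr[disjoint] I)
Pr[disjoint] {suc n} (inside ∷ I) = begin
  ½ ℚ.* 𝔼-bits n (λ _ → 0ℚ) ℚ.+ ½ ℚ.* 𝔼-bits n (λ N → 𝟙 (disjoint N I))
    ≡⟨ cong₂ (λ p q → ½ ℚ.* p ℚ.+ ½ ℚ.* q) (𝔼-const (𝔼-bits-isExpectation n) 0ℚ) (Pr[disjoint] I) ⟩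
  0ℚ ℚ.+ ½ ℚ.* ½^ ∣ I ∣ ≡⟨ ℚ.+-identityˡ _ ⟩
  ½ ℚ.* ½^ ∣ I ∣        ∎
  where open ≡-Reasoning

-- The binomial coefficient r(r - 1)/2, in the recursion that `Pr[independent]` follows: one more
-- vertex forms a pair with each of the r earlier ones.
choose₂ : ℕ → ℕ
choose₂ zero    = 0
choose₂ (suc r) = r ℕ.+ choose₂ r

-- The neighbourhood bits of vertex zero are independent of the rest of the graph, so including that
-- vertex multiplies the probability by the one in `Pr[disjoint]`.
Pr[independent] : ∀ {n} (I : Subset n) → 𝔼-graph n (λ G → 𝟙 (independent G I)) ≡ ½^ choose₂ ∣ I ∣
Pr[independent] [] = refl
Pr[independent] {suc n} (outside ∷ I) = trans
  (𝔼-cong (𝔼-graph-isExpectation n) λ G → 𝔼-const (𝔼-bits-isExpectation n) (𝟙 (independent G I)))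
  (Pr[independent] I)
Pr[independent] {suc n} (inside ∷ I) = begin
  𝔼-graph n (λ G → 𝔼-bits n λ N → 𝟙 (independent G I ∧ disjoint N I))
    ≡⟨ 𝔼-cong 𝔾 (λ G → trans
         (𝔼-cong 𝔹 λ N → 𝟙-∧ (independent G I) (disjoint N I))
         (trans (𝔼-* 𝔹 (𝟙 (independent G I)) _)
           (trans (cong (𝟙 (independent G I) ℚ.*_) (Pr[disjoint] I)) (ℚ.*-comm _ (½^ ∣ I ∣))))) ⟩
  𝔼-graph n (λ G → ½^ ∣ I ∣ ℚ.* 𝟙 (independent G I))
    ≡⟨ 𝔼-* 𝔾 (½^ ∣ I ∣) _ ⟩
  ½^ ∣ I ∣ ℚ.* 𝔼-graph n (λ G → 𝟙 (independent G I))
    ≡⟨ cong (½^ ∣ I ∣ ℚ.*_) (Pr[independent] I) ⟩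
  ½^ ∣ I ∣ ℚ.* ½^ choose₂ ∣ I ∣
    ≡⟨ ½^-+ ∣ I ∣ (choose₂ ∣ I ∣) ⟨
  ½^ choose₂ (suc ∣ I ∣) ∎
  where
  open ≡-Reasoning
  𝔾 = 𝔼-graph-isExpectation n
  𝔹 = 𝔼-bits-isExpectation n

-- First moment of the number of independent sets of a given size.

∑subsets : (n r : ℕ) → (Subset n → ℚ) → ℚ
∑subsets zero    zero    f = f []
∑subsets zero    (suc r) f = 0ℚ
∑subsets (suc n) zero    f = ∑subsets n zero (f ∘ (outside ∷_))
∑subsets (suc n) (suc r) f = ∑subsets n (suc r) (f ∘ (outside ∷_)) ℚ.+ ∑subsets n r (f ∘ (inside ∷_))

𝔼-∑subsets : ∀ {Ω : Set} {𝔼 : (Ω → ℚ) → ℚ} → IsExpectation 𝔼 → ∀ n r (f : Ω → Subset n → ℚ) →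
             𝔼 (λ ω → ∑subsets n r (f ω)) ≡ ∑subsets n r (λ I → 𝔼 λ ω → f ω I)
𝔼-∑subsets E zero    zero    f = refl
𝔼-∑subsets E zero    (suc r) f = 𝔼-const E 0ℚ
𝔼-∑subsets E (suc n) zero    f = 𝔼-∑subsets E n zero _
𝔼-∑subsets E (suc n) (suc r) f = trans (𝔼-+ E _ _)
  (cong₂ ℚ._+_ (𝔼-∑subsets E n (suc r) _) (𝔼-∑subsets E n r _))

∑subsets-nonNeg : ∀ n r {f} → (∀ I → 0ℚ ℚ.≤ f I) → 0ℚ ℚ.≤ ∑subsets n r f
∑subsets-nonNeg zero    zero    h = h []
∑subsets-nonNeg zero    (suc r) h = ℚ.≤-refl
∑subsets-nonNeg (suc n) zero    h = ∑subsets-nonNeg n zero (h ∘ (outside ∷_))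
∑subsets-nonNeg (suc n) (suc r) h = ℚ.+-mono-≤
  (∑subsets-nonNeg n (suc r) (h ∘ (outside ∷_))) (∑subsets-nonNeg n r (h ∘ (inside ∷_)))

p≤p+q : ∀ {p q} → 0ℚ ℚ.≤ q → p ℚ.≤ p ℚ.+ q
p≤p+q {p} {q} 0≤q = subst (ℚ._≤ p ℚ.+ q) (ℚ.+-identityʳ p) (ℚ.+-monoʳ-≤ p 0≤q)

p≤q+p : ∀ {p q} → 0ℚ ℚ.≤ q → p ℚ.≤ q ℚ.+ p
p≤q+p {p} {q} 0≤q = subst (ℚ._≤ q ℚ.+ p) (ℚ.+-identityˡ p) (ℚ.+-monoˡ-≤ p 0≤q)

term≤∑subsets : ∀ n {f} → (∀ I → 0ℚ ℚ.≤ f I) → ∀ I → f I ℚ.≤ ∑subsets n ∣ I ∣ f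
term≤∑subsets zero    h [] = ℚ.≤-refl
term≤∑subsets (suc n) h (inside ∷ I)  = ℚ.≤-trans (term≤∑subsets n (h ∘ (inside ∷_)) I)
  (p≤q+p (∑subsets-nonNeg n (suc ∣ I ∣) (h ∘ (outside ∷_))))
term≤∑subsets (suc n) {f} h (outside ∷ I) = ℚ.≤-trans (term≤∑subsets n (h ∘ (outside ∷_)) I)
  (outside≤ ∣ I ∣)
  where
  outside≤ : ∀ r → ∑subsets n r (f ∘ (outside ∷_)) ℚ.≤ ∑subsets (suc n) r f
  -- The split on `r` lets `∑subsets (suc n) r` unfold; a second summand is present only for
  -- positive `r`.
  outside≤ zero    = ℚ.≤-refl
  outside≤ (suc r) = p≤p+q (∑subsets-nonNeg n r (h ∘ (inside ∷_)))

-- A crude count: there are at most n^r subsets of size r. By the Pascal recursion of `∑subsets`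
-- this reduces to n^(r+1) + n^r = (n + 1) n^r ≤ (n + 1)^(r+1).
∑subsets≤ : ∀ n r {c f} → 0ℚ ℚ.≤ c → (∀ I → ∣ I ∣ ≡ r → f I ℚ.≤ c) →
            ∑subsets n r f ℚ.≤ ι (n ℕ.^ r) ℚ.* c
∑subsets≤ zero zero {c} 0≤c h = subst (_ ℚ.≤_) (sym (ℚ.*-identityˡ c)) (h [] refl)
∑subsets≤ zero (suc r) {c} 0≤c h = *-nonNeg (0≤ι 0) 0≤c
∑subsets≤ (suc n) zero 0≤c h = ∑subsets≤ n zero 0≤c (h ∘ (outside ∷_))
∑subsets≤ (suc n) (suc r) {c} {f} 0≤c h = begin
  ∑subsets n (suc r) (f ∘ (outside ∷_)) ℚ.+ ∑subsets n r (f ∘ (inside ∷_))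
    ≤⟨ ℚ.+-mono-≤ (∑subsets≤ n (suc r) 0≤c (h ∘ (outside ∷_)))
         (∑subsets≤ n r 0≤c λ I eq → h (inside ∷ I) (cong suc eq)) ⟩
  ι (n ℕ.^ suc r) ℚ.* c ℚ.+ ι (n ℕ.^ r) ℚ.* c
    ≡⟨ ℚ.*-distribʳ-+ c (ι (n ℕ.^ suc r)) (ι (n ℕ.^ r)) ⟨
  (ι (n ℕ.^ suc r) ℚ.+ ι (n ℕ.^ r)) ℚ.* c
    ≡⟨ cong (ℚ._* c) (ι-+ (n ℕ.^ suc r) (n ℕ.^ r)) ⟨
  ι (n ℕ.^ suc r ℕ.+ n ℕ.^ r) ℚ.* c
    ≤⟨ ℚ.*-monoʳ-≤-nonNeg c {{ℚ.nonNegative 0≤c}} (ι-mono-≤ powers) ⟩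
  ι (suc n ℕ.^ suc r) ℚ.* c ∎
  where
  open ℚ.≤-Reasoning
  powers : n ℕ.^ suc r ℕ.+ n ℕ.^ r ℕ.≤ suc n ℕ.^ suc r
  powers = subst (ℕ._≤ suc n ℕ.^ suc r) (ℕ.+-comm (n ℕ.^ r) (n ℕ.^ suc r))
    (ℕ.*-monoʳ-≤ (suc n) (ℕ.^-monoˡ-≤ r (ℕ.n≤1+n n)))

#independent : ∀ {n} → ℕ → Graph n → ℚ
#independent {n} r G = ∑subsets n r λ I → 𝟙 (independent G I)

0≤#independent : ∀ {n} r (G : Graph n) → 0ℚ ℚ.≤ #independent r G
0≤#independent {n} r G = ∑subsets-nonNeg n r (0≤𝟙 ∘ independent G)

𝔼#independent≤ : ∀ n r → 𝔼-graph n (#independent r) ℚ.≤ ι (n ℕ.^ r) ℚ.* ½^ choose₂ r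
𝔼#independent≤ n r = ℚ.≤-trans
  (ℚ.≤-reflexive (𝔼-∑subsets (𝔼-graph-isExpectation n) n r λ G I → 𝟙 (independent G I)))
  (∑subsets≤ n r (0≤½^ (choose₂ r))
    λ I eq → ℚ.≤-reflexive (trans (Pr[independent] I) (cong (λ t → ½^ choose₂ t) eq)))

-- Comparing the count with 1 yields a Boolean event, as `Pr≥` requires, and one to which Markov's
-- inequality applies directly.
hasNoIndependent : ∀ {n} → ℕ → Graph n → Bool
hasNoIndependent r G = ⌊ #independent r G ℚ.<? 1ℚ ⌋

-- An independent `I` would contribute a summand 1 to a sum of nonnegative terms, so the count could
-- not be below 1.
hasNoIndependent-sound : ∀ {n} (G : Graph n) I → T (hasNoIndependent ∣ I ∣ G) →
                         independent G I ≡ false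
hasNoIndependent-sound {n} G I h with independent G I in eq
... | false = refl
... | true  = contradiction (ℚ.≤-<-trans
  (subst (λ b → 𝟙 b ℚ.≤ #independent ∣ I ∣ G) eq (term≤∑subsets n (0≤𝟙 ∘ independent G) I))
  (toWitness {a? = #independent ∣ I ∣ G ℚ.<? 1ℚ} h)) (ℚ.<-irrefl refl)

-- For the nonnegative count X, pointwise 1 ≤ X + 𝟙[X < 1]; then take expectations.
markov : ∀ n r → 1ℚ ℚ.- 𝔼-graph n (#independent r) ℚ.≤ 𝔼-graph n (λ G → 𝟙 (hasNoIndependent r G))
markov n r = p≤q+r⇒p-q≤r {1ℚ} {𝔼-graph n (#independent r)} (begin
  1ℚ                                                             ≡⟨ 𝔼-const 𝔾 1ℚ ⟨
  𝔼-graph n (λ _ → 1ℚ)                                           ≤⟨ 𝔼-mono 𝔾 pointwise ⟩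
  𝔼-graph n (λ G → #independent r G ℚ.+ 𝟙 (hasNoIndependent r G)) ≡⟨ 𝔼-+ 𝔾 (#independent r) _ ⟩
  𝔼-graph n (#independent r) ℚ.+ 𝔼-graph n (λ G → 𝟙 (hasNoIndependent r G)) ∎)
  where
  open ℚ.≤-Reasoning
  𝔾 = 𝔼-graph-isExpectation n
  pointwise : ∀ G → 1ℚ ℚ.≤ #independent r G ℚ.+ 𝟙 (hasNoIndependent r G)
  pointwise G with #independent r G ℚ.<? 1ℚ
  ... | yes _ = p≤q+p (0≤#independent r G)
  ... | no  h = subst (1ℚ ℚ.≤_) (sym (ℚ.+-identityʳ _)) (ℚ.≮⇒≥ h)

-- For odd r the number (r - 1)/2 is natural, so the exponent is a multiple of r and the first
-- moment bound becomes an r-th power.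
choose₂[1+2m]≡m*[1+2m] : ∀ m → choose₂ (suc (m ℕ.+ m)) ≡ m ℕ.* suc (m ℕ.+ m)
choose₂[1+2m]≡m*[1+2m] zero    = refl
choose₂[1+2m]≡m*[1+2m] (suc m) = begin
  choose₂ (suc (suc m ℕ.+ suc m))   ≡⟨ cong (λ t → choose₂ (2 ℕ.+ t)) (ℕ.+-suc m m) ⟩
  choose₂ (3 ℕ.+ (m ℕ.+ m))
    ≡⟨ cong (λ t → (2 ℕ.+ s) ℕ.+ ((1 ℕ.+ s) ℕ.+ t)) (choose₂[1+2m]≡m*[1+2m] m) ⟩
  (2 ℕ.+ s) ℕ.+ ((1 ℕ.+ s) ℕ.+ m ℕ.* suc s) ≡⟨ arith m ⟩
  suc m ℕ.* suc (suc m ℕ.+ suc m)   ∎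
  where
  open ≡-Reasoning
  s = m ℕ.+ m
  arith : ∀ m → (2 ℕ.+ (m ℕ.+ m)) ℕ.+ ((1 ℕ.+ (m ℕ.+ m)) ℕ.+ m ℕ.* suc (m ℕ.+ m)) ≡
                suc m ℕ.* suc (suc m ℕ.+ suc m)
  arith = solve-∀

-- For r = 1 + 2(m + 1), choose₂ r = (m + 1) r, so the first moment is at most (n / 2 ^ (m + 1)) ^ r.

𝔼#independent≤½^ : ∀ {n} m → n ℕ.≤ 2 ℕ.^ m → ∀ {r} → r ≡ suc (suc m ℕ.+ suc m) →
                    𝔼-graph n (#independent r) ℚ.≤ ½^ r
𝔼#independent≤½^ {n} m n≤2^m {r} eq = begin
  𝔼-graph n (#independent r)                    ≤⟨ 𝔼#independent≤ n r ⟩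
  ι (n ℕ.^ r) ℚ.* ½^ choose₂ r                   ≡⟨ cong (λ t → ι (n ℕ.^ r) ℚ.* ½^ t) exponent ⟩
  ι (n ℕ.^ r) ℚ.* ½^ (m ℕ.* r ℕ.+ r)             ≡⟨ cong (ι (n ℕ.^ r) ℚ.*_) (½^-+ (m ℕ.* r) r) ⟩
  ι (n ℕ.^ r) ℚ.* (½^ (m ℕ.* r) ℚ.* ½^ r)       ≡⟨ ℚ.*-assoc (ι (n ℕ.^ r)) _ _ ⟨
  ι (n ℕ.^ r) ℚ.* ½^ (m ℕ.* r) ℚ.* ½^ r
    ≤⟨ ℚ.*-monoʳ-≤-nonNeg (½^ r) {{ℚ.nonNegative (0≤½^ r)}} (n*½^m≤1 {m = m ℕ.* r} powers) ⟩
  1ℚ ℚ.* ½^ r                                    ≡⟨ ℚ.*-identityˡ _ ⟩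
  ½^ r                                           ∎
  where
  open ℚ.≤-Reasoning
  exponent : choose₂ r ≡ m ℕ.* r ℕ.+ r
  exponent = trans (subst (λ r → choose₂ r ≡ suc m ℕ.* r) (sym eq) (choose₂[1+2m]≡m*[1+2m] (suc m)))
    (ℕ.+-comm r (m ℕ.* r))
  powers : n ℕ.^ r ℕ.≤ 2 ℕ.^ (m ℕ.* r)
  powers = ℕ.≤-trans (ℕ.^-monoˡ-≤ r n≤2^m) (ℕ.≤-reflexive (ℕ.^-*-assoc 2 m r))

-- With l = ⌊log₂ n⌋ this is 2l + 5, in the shape suc (suc m + suc m) for m = 1 + l, where n < 2^m.
-- The two vertices beyond 2m + 1 are what leaves the vanishing factor ½^r in the first moment.
threshold : ℕ → ℕ
threshold n = suc ((2 ℕ.+ ⌊log₂ n ⌋) ℕ.+ (2 ℕ.+ ⌊log₂ n ⌋))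

n*1/n≡1 : ∀ n → ι (suc n) ℚ.* (+ 1 / suc n) ≡ 1ℚ
n*1/n≡1 n = ℚ.toℚᵘ-injective (ℚᵘ.≃-trans (ℚ.toℚᵘ-homo-* (ι (suc n)) (+ 1 / suc n))
  (ℚᵘ.≃-trans (ℚᵘ.*-cong (ℚ.toℚᵘ-fromℚᵘ (ℚᵘ.mkℚᵘ (+ suc n) 0)) (ℚ.toℚᵘ-fromℚᵘ (ℚᵘ.mkℚᵘ (+ 1) n)))
    (ℚᵘ.*≡* (cong (λ t → + suc t) (trans (ℕ.*-identityʳ (n ℕ.* 1))
      (trans (ℕ.*-identityʳ n) (sym (trans (ℕ.+-identityʳ _) (ℕ.+-identityʳ n)))))))))

-- The condition bounds 2^r rather than r, so that it follows from N ≤ n ≤ 2^r.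
½^-small : ∀ {ε} → 0ℚ ℚ.< ε → ∃[ N ] ∀ {r} → N ℕ.≤ 2 ℕ.^ r → ½^ r ℚ.≤ ε
½^-small {ε} 0<ε = let N , 1/N≤ε = archimedean 0<ε in suc N , λ {r} h → ℚ.≤-trans
  (ℚ.*-cancelˡ-≤-pos (ι (suc N)) {{ℚ.normalize-pos (suc N) 1}}
    (subst (ι (suc N) ℚ.* ½^ r ℚ.≤_) (sym (n*1/n≡1 N)) (n*½^m≤1 {m = r} h)))
  1/N≤ε

hasNoIndependent-whp : WithHighProbability λ n G → T (hasNoIndependent (threshold n) G)
hasNoIndependent-whp ε 0<ε = let N , small = ½^-small 0<ε in N , λ n N≤n →
  hasNoIndependent (threshold n) , (λ _ h → h) ,
  ℚ.≤-trans (ℚ.+-monoʳ-≤ 1ℚ (ℚ.neg-antimono-≤ (ℚ.≤-trans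
    (𝔼#independent≤½^ (suc ⌊log₂ n ⌋) (ℕ.<⇒≤ (n<2^[1+⌊log₂n⌋] n)) refl)
    -- N ≤ n < 2^(1 + l) ≤ 2^r, for l = ⌊log₂ n⌋ and r = `threshold n`.
    (small {threshold n} (ℕ.≤-trans N≤n (ℕ.≤-trans (ℕ.<⇒≤ (n<2^[1+⌊log₂n⌋] n))
      (ℕ.^-monoʳ-≤ 2 (ℕ.≤-trans (ℕ.n≤1+n _) (ℕ.m≤n⇒m≤1+n (ℕ.m≤m+n (2 ℕ.+ ⌊log₂ n ⌋) _))))))))))
    (markov n (threshold n))

disjoint-false : ∀ {n} (N : Vec Bool n) I → disjoint N I ≡ false →
                 ∃[ j ] lookup N j ≡ true × lookup I j ≡ inside
disjoint-false []      []            ()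
disjoint-false (b ∷ N) (outside ∷ I) h =
  let j , p , q = disjoint-false N I h in Fin.suc j , p , q
disjoint-false (true ∷ N) (inside ∷ I) h = Fin.zero , refl , refl
disjoint-false (false ∷ N) (inside ∷ I) h =
  let j , p , q = disjoint-false N I h in Fin.suc j , p , q

-- Produces the edge to which the edge axiom is applied. That `i ≢ j` is recorded so that `j` is
-- still a member after `i` has been removed.
independent-false : ∀ {n} (G : Graph n) I → independent G I ≡ false →
  ∃[ i ] ∃[ j ] i ≢ j × T (adjacent G i j) × lookup I i ≡ inside × lookup I j ≡ inside
independent-false ∅       []            ()
independent-false (G ▷ N) (outside ∷ I) h with independent-false G I h
... | i , j , i≢j , ij , i∈I , j∈I = Fin.suc i , Fin.suc j , (λ { refl → i≢j refl }) , ij , i∈I , j∈I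
independent-false (G ▷ N) (inside ∷ I) h with independent G I in eq
... | true  = let j , p , q = disjoint-false N I h in
  Fin.zero , Fin.suc j , (λ ()) , subst T (sym p) tt , refl , q
... | false with independent-false G I eq
... | i , j , i≢j , ij , i∈I , j∈I = Fin.suc i , Fin.suc j , (λ { refl → i≢j refl }) , ij , i∈I , j∈I

-- Real numbers

module ℝ-Ring = CommutativeRing ℝ-commutativeRing
module ℝ-Sum = SemiringSum ℝ-Ring.semiring

≈⇒≤ : ∀ {x y} → x ≈ y → x ≤ y
≈⇒≤ {x} {y} (*≈* h) = *≤* λ ε 0<ε → let N , p = h ε 0<ε in N , λ n N≤n →
  subst (ℚ._≤ seq y n ℚ.+ ε) (solve 2 (λ a b → b :+ (a :- b) := a) refl (seq x n) (seq y n))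
    (ℚ.+-monoʳ-≤ (seq y n) (ℚ.≤-trans (p≤∣p∣ (seq x n ℚ.- seq y n)) (p n N≤n)))
  where
  open +-*-Solver
  p≤∣p∣ : ∀ p → p ℚ.≤ ℚ.∣ p ∣
  p≤∣p∣ p with ℚ.≤-total 0ℚ p
  ... | inj₁ 0≤p = ℚ.≤-reflexive (sym (ℚ.0≤p⇒∣p∣≡p 0≤p))
  ... | inj₂ p≤0 = ℚ.≤-trans p≤0 (ℚ.0≤∣p∣ p)

≤-refl : ∀ {x} → x ≤ x
≤-refl = ≈⇒≤ (≡⇒≈ λ _ → refl)

≤-trans : ∀ {x y z} → x ≤ y → y ≤ z → x ≤ z
≤-trans {x} {y} {z} (*≤* h) (*≤* k) = *≤* λ ε 0<ε → eventually-∩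
  (λ {n} p q → ℚ.≤-trans p (subst (seq y n ℚ.+ ½ ℚ.* ε ℚ.≤_)
    (trans (ℚ.+-assoc (seq z n) _ _) (cong (seq z n ℚ.+_) (halves ε)))
    (ℚ.+-monoˡ-≤ (½ ℚ.* ε) q)))
  (h (½ ℚ.* ε) (0<½*ε 0<ε)) (k (½ ℚ.* ε) (0<½*ε 0<ε))

+-mono-≤ : ∀ {x y u v} → x ≤ y → u ≤ v → x + u ≤ y + v
+-mono-≤ {x} {y} {u} {v} (*≤* h) (*≤* k) = *≤* λ ε 0<ε → eventually-∩
  (λ {n} p q → subst (seq x n ℚ.+ seq u n ℚ.≤_)
    (trans (solve 4 (λ a b c d → (a :+ c) :+ (b :+ d) := (a :+ b) :+ (c :+ d))
        refl (seq y n) (seq v n) (½ ℚ.* ε) (½ ℚ.* ε))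
      (cong (seq y n ℚ.+ seq v n ℚ.+_) (halves ε)))
    (ℚ.+-mono-≤ p q))
  (h (½ ℚ.* ε) (0<½*ε 0<ε)) (k (½ ℚ.* ε) (0<½*ε 0<ε))
  where open +-*-Solver

≤-preorder : Preorder 0ℓ 0ℓ 0ℓ
≤-preorder = record
  { isPreorder = record { isEquivalence = ≈-isEquivalence ; reflexive = ≈⇒≤ ; trans = ≤-trans } }

module ≤-Reasoning where
  open import Relation.Binary.Reasoning.Preorder ≤-preorder public
    renaming (step-≲ to step-≤)
  infixr 2 _≤⟨_⟩_
  _≤⟨_⟩_ : ∀ x {y z} → x ≤ y → y IsRelatedTo z → x IsRelatedTo z
  _ ≤⟨ h ⟩ k = step-≤ _ k h

seq≤⇒≤ : ∀ {x y} → Eventually (λ n → seq x n ℚ.≤ seq y n) → x ≤ y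
seq≤⇒≤ (N , p) = *≤* λ ε 0<ε → N , λ n N≤n → ℚ.≤-trans (p n N≤n) (p≤p+q (ℚ.<⇒≤ 0<ε))

fromℕ-mono-≤ : ∀ {m n} → m ℕ.≤ n → fromℕ m ≤ fromℕ n
fromℕ-mono-≤ m≤n = seq≤⇒≤ (0 , λ _ _ → ι-mono-≤ m≤n)

fromℕ-cancel-≤ : ∀ {m n} → fromℕ m ≤ fromℕ n → m ℕ.≤ n
-- With ε = ½, the assumption n < m would give n + 1 ≤ n + ½.
fromℕ-cancel-≤ {m} {n} (*≤* h) with h ½ (ℚ.positive⁻¹ ½)
... | N , p = ℕ.≮⇒≥ λ n<m → ℚ.<-irrefl refl (ℚ.<-≤-trans
  (ℚ.+-monoʳ-< (ι n) (toWitness {a? = ½ ℚ.<? 1ℚ} tt))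
  (subst (ℚ._≤ ι n ℚ.+ ½) (ι-+ n 1)
    (ℚ.≤-trans (ι-mono-≤ (subst (ℕ._≤ m) (ℕ.+-comm 1 n) n<m)) (p N ℕ.≤-refl))))

fromℕ-+ : ∀ m n → fromℕ (m ℕ.+ n) ≈ fromℕ m + fromℕ n
fromℕ-+ m n = ≡⇒≈ λ _ → ι-+ m n

-- As t x + (1 + s) x ≤ t x + ε, either x ≤ 0 or x ≤ (1 + s) x ≤ ε.

multiple≤⇒≤0 : ∀ {t r} x → t ℕ.< r → fromℕ r * x ≤ fromℕ t * x → x ≤ 0ℝ
multiple≤⇒≤0 {t} {r} x t<r (*≤* h) = *≤* λ ε 0<ε → let N , p = h ε 0<ε in N , λ n N≤n →
  subst (seq x n ℚ.≤_) (sym (ℚ.+-identityˡ ε)) (small (ℚ.<⇒≤ 0<ε) (p n N≤n))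
  where
  open +-*-Solver
  s = r ℕ.∸ suc t
  r≡ : ι r ≡ ι t ℚ.+ (1ℚ ℚ.+ ι s)
  r≡ = trans (cong ι (trans (sym (ℕ.m+[n∸m]≡n t<r)) (sym (ℕ.+-suc t s))))
    (trans (ι-+ t (suc s)) (cong (ι t ℚ.+_) (ι-+ 1 s)))
  small : ∀ {q ε} → 0ℚ ℚ.≤ ε → ι r ℚ.* q ℚ.≤ ι t ℚ.* q ℚ.+ ε → q ℚ.≤ ε
  small {q} {ε} 0≤ε h with ℚ.≤-total q 0ℚ
  ... | inj₁ q≤0 = ℚ.≤-trans q≤0 0≤ε
  ... | inj₂ 0≤q = begin
    q                                 ≤⟨ p≤p+q (*-nonNeg (0≤ι s) 0≤q) ⟩
    q ℚ.+ ι s ℚ.* q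
      ≡⟨ solve 3 (λ q a b → q :+ b :* q := (a :+ (con 1ℚ :+ b)) :* q :- a :* q) refl q (ι t) (ι s) ⟩
    (ι t ℚ.+ (1ℚ ℚ.+ ι s)) ℚ.* q ℚ.- ι t ℚ.* q ≡⟨ cong (λ z → z ℚ.* q ℚ.- ι t ℚ.* q) r≡ ⟨
    ι r ℚ.* q ℚ.- ι t ℚ.* q           ≤⟨ p≤q+r⇒p-q≤r h ⟩
    ε                                 ∎
    where open ℚ.≤-Reasoning

sum-mono-≤ : ∀ {n} {f g : Fin n → ℝ} → (∀ i → f i ≤ g i) → ℝ-Sum.sum f ≤ ℝ-Sum.sum g
sum-mono-≤ {zero}  h = ≤-refl
sum-mono-≤ {suc n} h = +-mono-≤ (h Fin.zero) (sum-mono-≤ (h ∘ Fin.suc))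

sum-const : ∀ n m → ℝ-Sum.sum {n} (λ _ → fromℕ m) ≈ fromℕ (n ℕ.* m)
sum-const zero    m = ℝ-Ring.refl
sum-const (suc n) m = ℝ-Ring.trans (ℝ-Ring.+-congˡ (sum-const n m)) (ℝ-Ring.sym (fromℕ-+ m (n ℕ.* m)))

sum-indicator : ∀ {n} (I : Subset n) q →
                ℝ-Sum.sum (λ i → if lookup I i then q else 0ℝ) ≈ fromℕ ∣ I ∣ * q
sum-indicator []            q = ℝ-Ring.sym (ℝ-Ring.zeroˡ q)
sum-indicator (outside ∷ I) q = ℝ-Ring.trans (ℝ-Ring.+-identityˡ _) (sum-indicator I q)
sum-indicator (inside ∷ I)  q = begin
  q + ℝ-Sum.sum (λ i → if lookup I i then q else 0ℝ)
    ≈⟨ ℝ-Ring.+-cong (ℝ-Ring.sym (ℝ-Ring.*-identityˡ q)) (sum-indicator I q) ⟩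
  1ℝ * q + fromℕ ∣ I ∣ * q                            ≈⟨ ℝ-Ring.distribʳ q 1ℝ (fromℕ ∣ I ∣) ⟨
  (1ℝ + fromℕ ∣ I ∣) * q                              ≈⟨ ℝ-Ring.*-congʳ (fromℕ-+ 1 ∣ I ∣) ⟨
  fromℕ (suc ∣ I ∣) * q                               ∎
  where open import Relation.Binary.Reasoning.Setoid ≈-setoid

-- Provides the real degree conditions d/2 and, together with `difference-bound`, (d - 1)/2 from
-- inequalities between naturals.
half-bound : ∀ m {d} → fromℕ (m ℕ.+ m) ≤ d → fromℕ m ≤ fromℚ ½ * d
half-bound m {d} (*≤* h) = *≤* λ ε 0<ε → let N , p = h ε 0<ε in N , λ n N≤n → begin
    ι m                        ≡⟨ halves (ι m) ⟨
    ½ ℚ.* ι m ℚ.+ ½ ℚ.* ι m    ≡⟨ ℚ.*-distribˡ-+ ½ (ι m) (ι m) ⟨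
    ½ ℚ.* (ι m ℚ.+ ι m)        ≡⟨ cong (½ ℚ.*_) (ι-+ m m) ⟨
    ½ ℚ.* ι (m ℕ.+ m)          ≤⟨ ℚ.*-monoˡ-≤-nonNeg ½ (p n N≤n) ⟩
    ½ ℚ.* (seq d n ℚ.+ ε)      ≡⟨ ℚ.*-distribˡ-+ ½ (seq d n) ε ⟩
    ½ ℚ.* seq d n ℚ.+ ½ ℚ.* ε  ≤⟨ ℚ.+-monoʳ-≤ (½ ℚ.* seq d n) (p≤p+q (ℚ.<⇒≤ (0<½*ε 0<ε))) ⟩
    ½ ℚ.* seq d n ℚ.+ (½ ℚ.* ε ℚ.+ ½ ℚ.* ε) ≡⟨ cong (½ ℚ.* seq d n ℚ.+_) (halves ε) ⟩
    ½ ℚ.* seq d n ℚ.+ ε        ∎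
  where open ℚ.≤-Reasoning

difference-bound : ∀ m l {d} → fromℕ (m ℕ.+ l) ≤ d → fromℕ m ≤ d - fromℕ l
difference-bound m l {d} (*≤* h) = *≤* λ ε 0<ε → let N , p = h ε 0<ε in N , λ n N≤n → begin
    ι m                        ≡⟨ solve 2 (λ a b → a := (a :+ b) :- b) refl (ι m) (ι l) ⟩
    ι m ℚ.+ ι l ℚ.- ι l        ≡⟨ cong (ℚ._- ι l) (ι-+ m l) ⟨
    ι (m ℕ.+ l) ℚ.- ι l        ≤⟨ ℚ.+-monoˡ-≤ (ℚ.- ι l) (p n N≤n) ⟩
    seq d n ℚ.+ ε ℚ.- ι l      ≡⟨ solve 3 (λ a b c → a :+ b :- c := a :- c :+ b) refl (seq d n) ε (ι l) ⟩
    seq d n ℚ.- ι l ℚ.+ ε      ∎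
  where
  open ℚ.≤-Reasoning
  open +-*-Solver

-- Formal degrees and monomials.

∑ᵖ-degree : ∀ {V n m} {f : Fin n → Poly V} → (∀ i → formalDegree (f i) ℕ.≤ m) → formalDegree (∑ᵖ f) ℕ.≤ m
∑ᵖ-degree {n = zero}  h = ℕ.z≤n
∑ᵖ-degree {n = suc n} h = ℕ.⊔-lub (h Fin.zero) (∑ᵖ-degree (h ∘ Fin.suc))

module Monomials {V : Set} where

  module Ring = CommutativeRing (polynomialRing V)
  module Sum = SemiringSum Ring.semiring
  module Solver = SemiringSolver Ring.commutativeSemiring
  open import Relation.Binary.Reasoning.Setoid (≈ᵖ-setoid V)

  -- The family `v` is arbitrary so that the recursion can shift it past the first vertex.
  monomial : ∀ {n} → (Fin n → V) → Subset n → Poly V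
  monomial v []            = 1ᵖ
  monomial v (outside ∷ I) = monomial (v ∘ Fin.suc) I
  monomial v (inside ∷ I)  = var (v Fin.zero) *ᵖ monomial (v ∘ Fin.suc) I

  monomial-degree : ∀ {n} (v : Fin n → V) I → formalDegree (monomial v I) ≡ ∣ I ∣
  monomial-degree v []            = refl
  monomial-degree v (outside ∷ I) = monomial-degree (v ∘ Fin.suc) I
  monomial-degree v (inside ∷ I)  = cong suc (monomial-degree (v ∘ Fin.suc) I)

  x∙yz≈y∙xz : ∀ p q r → p *ᵖ (q *ᵖ r) ≈ᵖ q *ᵖ (p *ᵖ r)
  x∙yz≈y∙xz = Solver.solve 3 (λ p q r → p :* (q :* r) := q :* (p :* r)) ≈ᵖ-refl
    where open Solver

  -- This and `monomial-remove` are identities of the polynomial ring itself; squares of variables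
  -- are introduced or reduced only later, through the Boolean axiom.
  monomial-insert : ∀ {n} (v : Fin n → V) I i → lookup I i ≡ outside →
                    monomial v (I [ i ]≔ inside) ≈ᵖ var (v i) *ᵖ monomial v I
  monomial-insert v (outside ∷ I) Fin.zero    h = ≈ᵖ-refl
  monomial-insert v (outside ∷ I) (Fin.suc i) h = monomial-insert (v ∘ Fin.suc) I i h
  monomial-insert v (inside ∷ I)  (Fin.suc i) h = ≈ᵖ-trans
    (*ᵖ-cong ≈ᵖ-refl (monomial-insert (v ∘ Fin.suc) I i h))
    (x∙yz≈y∙xz _ _ _)

  monomial-remove : ∀ {n} (v : Fin n → V) I i → lookup I i ≡ inside →
                    monomial v I ≈ᵖ var (v i) *ᵖ monomial v (I [ i ]≔ outside)
  monomial-remove v (inside ∷ I)  Fin.zero    h = ≈ᵖ-refl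
  monomial-remove v (outside ∷ I) (Fin.suc i) h = monomial-remove (v ∘ Fin.suc) I i h
  monomial-remove v (inside ∷ I)  (Fin.suc i) h = ≈ᵖ-trans
    (*ᵖ-cong ≈ᵖ-refl (monomial-remove (v ∘ Fin.suc) I i h))
    (x∙yz≈y∙xz _ _ _)

∣insert∣ : ∀ {n} (I : Subset n) i → lookup I i ≡ outside → ∣ I [ i ]≔ inside ∣ ≡ suc ∣ I ∣
∣insert∣ (outside ∷ I) Fin.zero    h = refl
∣insert∣ (outside ∷ I) (Fin.suc i) h = ∣insert∣ I i h
∣insert∣ (inside ∷ I)  (Fin.suc i) h = cong suc (∣insert∣ I i h)

∣remove∣≤ : ∀ {n} (I : Subset n) i → ∣ I [ i ]≔ outside ∣ ℕ.≤ ∣ I ∣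
∣remove∣≤ (outside ∷ I) Fin.zero    = ℕ.≤-refl
∣remove∣≤ (inside ∷ I)  Fin.zero    = ℕ.n≤1+n _
∣remove∣≤ (outside ∷ I) (Fin.suc i) = ∣remove∣≤ I i
∣remove∣≤ (inside ∷ I)  (Fin.suc i) = ℕ.s≤s (∣remove∣≤ I i)

-- Pseudo-expectations on expressions of bounded formal degree.

module Restricted {d n k} {G : Graph n} (P : ColoringPseudoExpectation d G k)
                  (D : ℕ) (D≤d : fromℕ D ≤ d) where

  open ColoringPseudoExpectation P public
  open Monomials {Fin n × Fin k} public

  deg : Polynomial → ℕ
  deg = formalDegree

  -- The expression `f` is its own witness of low degree, so membership in the domain becomes
  -- arithmetic of formal degrees.
  within : ∀ f {m b} → deg f ℕ.≤ m → fromℕ m ≤ b → Degree≤ b f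
  within f h k = inj₂ (f , ≈ᵖ-refl , ≤-trans (fromℕ-mono-≤ h) k)

  -- The junk value 0 on expressions of formal degree above D makes E total.

  abstract

    E : Polynomial → ℝ
    E f with deg f ℕ.≤? D
    ... | yes h = 𝔼̃ f (within f h D≤d)
    ... | no  _ = 0ℝ

    E≈𝔼̃ : ∀ f → deg f ℕ.≤ D → ∀ h → E f ≈ 𝔼̃ f h
    E≈𝔼̃ f p h with deg f ℕ.≤? D
    ... | yes q = 𝔼̃-cong (within f q D≤d) h ≈ᵖ-refl
    ... | no ¬p = contradiction p ¬p

  E-𝔼̃ : ∀ f (p : deg f ℕ.≤ D) → E f ≈ 𝔼̃ f (within f p D≤d)
  E-𝔼̃ f p = E≈𝔼̃ f p _

  E-cong : ∀ {f g} → deg f ℕ.≤ D → deg g ℕ.≤ D → f ≈ᵖ g → E f ≈ E g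
  E-cong {f} {g} p q f≈g = ≈-trans (E-𝔼̃ f p)
    (≈-trans (𝔼̃-cong (within f p D≤d) (within g q D≤d) f≈g) (≈-sym (E-𝔼̃ g q)))

  E-+ : ∀ f g → deg f ℕ.≤ D → deg g ℕ.≤ D → E (f +ᵖ g) ≈ E f + E g
  E-+ f g p q = ≈-trans (E-𝔼̃ (f +ᵖ g) (ℕ.⊔-lub p q))
    (≈-trans (𝔼̃-+ f g (within f p D≤d) (within g q D≤d) _)
      (≈-sym (+-cong (E-𝔼̃ f p) (E-𝔼̃ g q))))

  E-scale : ∀ a f → deg f ℕ.≤ D → E (con a *ᵖ f) ≈ a * E f
  E-scale a f p = ≈-trans (E-𝔼̃ (con a *ᵖ f) p)
    (≈-trans (𝔼̃-scale a f (within f p D≤d) _) (ℝ-Ring.*-congˡ (≈-sym (E-𝔼̃ f p))))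

  E-one : E 1ᵖ ≈ 1ℝ
  E-one = let h , eq = 𝔼̃-one in ≈-trans (E≈𝔼̃ 1ᵖ ℕ.z≤n h) eq

  E-con : ∀ a → E (con a) ≈ a
  E-con a = ≈-trans (E-cong ℕ.z≤n ℕ.z≤n (Ring.sym (Ring.*-identityʳ (con a))))
    (≈-trans (E-scale a 1ᵖ ℕ.z≤n) (≈-trans (ℝ-Ring.*-congˡ E-one) (ℝ-Ring.*-identityʳ a)))

  E-∑ : ∀ {m} (f : Fin m → Polynomial) → (∀ i → deg (f i) ℕ.≤ D) → E (∑ᵖ f) ≈ ℝ-Sum.sum (E ∘ f)
  E-∑ {zero}  f h = E-con 0ℝ
  E-∑ {suc m} f h = ≈-trans (E-+ (f Fin.zero) _ (h Fin.zero) (∑ᵖ-degree (h ∘ Fin.suc)))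
    (ℝ-Ring.+-congˡ (E-∑ (f ∘ Fin.suc) (h ∘ Fin.suc)))

  E-square : ∀ f → deg f ℕ.+ deg f ℕ.≤ D → 0ℝ ≤ E (f *ᵖ f)
  E-square f p = ≤-trans
    (𝔼̃-square f (within f ℕ.≤-refl (half-bound (deg f) (≤-trans (fromℕ-mono-≤ p) D≤d)))
      (within (f *ᵖ f) p D≤d))
    (≈⇒≤ (≈-sym (E-𝔼̃ (f *ᵖ f) p)))

  degree-2 : ∀ f → deg f ℕ.+ 2 ℕ.≤ D → Degree≤ (d - fromℕ 2) f
  degree-2 f p = within f ℕ.≤-refl (difference-bound (deg f) 2 (≤-trans (fromℕ-mono-≤ p) D≤d))

  E-boolean : ∀ f i c → deg f ℕ.+ 2 ℕ.≤ D → E (f *ᵖ (x i c *ᵖ x i c)) ≈ E (f *ᵖ x i c)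
  E-boolean f i c p = begin
    E (f *ᵖ (y *ᵖ y))                       ≈⟨ E-cong p (ℕ.⊔-lub p p₁) split ⟩
    E (f *ᵖ (y *ᵖ y -ᵖ y) +ᵖ f *ᵖ y)        ≈⟨ E-+ _ _ p p₁ ⟩
    E (f *ᵖ (y *ᵖ y -ᵖ y)) + E (f *ᵖ y)
      ≈⟨ +-cong (≈-trans (E-𝔼̃ _ p) (𝔼̃-boolean f (degree-2 f p) i c _)) ℝ-Ring.refl ⟩
    0ℝ + E (f *ᵖ y)                         ≈⟨ ℝ-Ring.+-identityˡ _ ⟩
    E (f *ᵖ y)                              ∎
    where
    open import Relation.Binary.Reasoning.Setoid ≈-setoid
    y = x i c
    p₁ : deg (f *ᵖ y) ℕ.≤ D
    p₁ = ℕ.≤-trans (ℕ.+-monoʳ-≤ (deg f) (ℕ.n≤1+n 1)) p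
    split : f *ᵖ (y *ᵖ y) ≈ᵖ f *ᵖ (y *ᵖ y -ᵖ y) +ᵖ f *ᵖ y
    split = Ring.trans (Ring.*-congˡ (Ring.sym (Ring.trans (Ring.+-assoc _ _ _)
      (Ring.trans (Ring.+-congˡ (Ring.-‿inverseˡ y)) (Ring.+-identityʳ _))))) (Ring.distribˡ f _ y)

  E-edge : ∀ f i j c → T (adjacent G i j) → deg f ℕ.+ 2 ℕ.≤ D → E (f *ᵖ (x i c *ᵖ x j c)) ≈ 0ℝ
  E-edge f i j c ij p = ≈-trans (E-𝔼̃ _ p) (𝔼̃-edge f (degree-2 f p) i j ij c _)

  -- The coloring axiom for the square of the constant 1, with 𝔼̃[1] = 1 added to both sides.
  E-colored : 1 ℕ.≤ D → ∀ i → 1ℝ ≤ E (∑ᵖ (x i))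
  E-colored 1≤D i = begin
    1ℝ                               ≈⟨ ℝ-Ring.+-identityˡ 1ℝ ⟨
    0ℝ + 1ℝ
      ≤⟨ +-mono-≤ (≤-trans (𝔼̃-colored 1ᵖ 0≤ i (within _ p D≤d)) (≈⇒≤ (≈-sym (E-𝔼̃ _ p))))
           (≈⇒≤ (≈-sym E-one)) ⟩
    E (1ᵖ *ᵖ 1ᵖ *ᵖ (s -ᵖ 1ᵖ)) + E 1ᵖ ≈⟨ E-+ _ _ p ℕ.z≤n ⟨
    E (1ᵖ *ᵖ 1ᵖ *ᵖ (s -ᵖ 1ᵖ) +ᵖ 1ᵖ)  ≈⟨ E-cong (ℕ.⊔-lub p ℕ.z≤n) (ℕ.≤-trans s≤1 1≤D) eq ⟩
    E s                              ∎
    where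
    open ≤-Reasoning
    s = ∑ᵖ (x i)
    s≤1 : deg s ℕ.≤ 1
    s≤1 = ∑ᵖ-degree {f = x i} λ _ → ℕ.≤-refl
    p : deg (1ᵖ *ᵖ 1ᵖ *ᵖ (s -ᵖ 1ᵖ)) ℕ.≤ D
    p = ℕ.⊔-lub (ℕ.≤-trans s≤1 1≤D) ℕ.z≤n
    -- 0 ≤ (d - 1)/2 because 1 ≤ D ≤ d.
    0≤ : Degree≤ (fromℚ ½ * (d - 1ℝ)) 1ᵖ
    0≤ = within 1ᵖ {0} ℕ.≤-refl (half-bound 0 (difference-bound 0 1 (≤-trans (fromℕ-mono-≤ 1≤D) D≤d)))
    eq : 1ᵖ *ᵖ 1ᵖ *ᵖ (s -ᵖ 1ᵖ) +ᵖ 1ᵖ ≈ᵖ s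
    eq = Ring.trans (Ring.+-congʳ (Ring.trans (Ring.*-congʳ (Ring.*-identityˡ 1ᵖ)) (Ring.*-identityˡ _)))
      (Ring.trans (Ring.+-assoc _ _ _) (Ring.trans (Ring.+-congˡ (Ring.-‿inverseˡ 1ᵖ)) (Ring.+-identityʳ s)))

-- Color classes

module ColorClass {d n k} {G : Graph n} (P : ColoringPseudoExpectation d G k) (r : ℕ)
                  (4+2r≤d : fromℕ (4 ℕ.+ (r ℕ.+ r)) ≤ d)
                  (dependent : ∀ I → ∣ I ∣ ≡ r → independent G I ≡ false) where

  -- The degrees below are bounded by 2r + 3: 2r for two monomials, 1 for `U`, and 2 for the product
  -- of variables in an axiom.
  D : ℕ
  D = 4 ℕ.+ (r ℕ.+ r)

  open Restricted P D 4+2r≤d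

  size : Fin k → Polynomial
  size c = ∑ᵖ λ i → x i c

  size-degree : ∀ c → deg (size c) ℕ.≤ 1
  size-degree c = ∑ᵖ-degree {f = λ i → x i c} λ _ → ℕ.≤-refl

  1≤D : 1 ℕ.≤ D
  1≤D = ℕ.s≤s ℕ.z≤n

  module _ (c : Fin k) where

    M : Subset n → Polynomial
    M = monomial λ i → i , c

    U : Polynomial
    U = size c +ᵖ con (- fromℕ r)

    U-degree : deg U ℕ.≤ 1
    U-degree = ℕ.⊔-lub (size-degree c) ℕ.z≤n

    M-degree : ∀ I → deg (M I) ≡ ∣ I ∣
    M-degree = monomial-degree λ i → i , c

    size≈U+r : size c ≈ᵖ U +ᵖ con (fromℕ r)
    size≈U+r = Ring.sym (Ring.trans (Ring.+-assoc _ _ _)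
      (Ring.trans (Ring.+-congˡ (Ring.trans (Ring.sym (con-+ _ _)) (con-cong (-‿inverseˡ (fromℕ r)))))
        (Ring.+-identityʳ (size c))))

    MMU-degree : ∀ {p q s} → deg p ℕ.≤ s → deg q ℕ.≤ s → deg (p *ᵖ q *ᵖ U) ℕ.≤ 1 ℕ.+ (s ℕ.+ s)
    MMU-degree {s = s} hp hq = ℕ.≤-trans (ℕ.+-mono-≤ (ℕ.+-mono-≤ hp hq) U-degree)
      (ℕ.≤-reflexive (ℕ.+-comm (s ℕ.+ s) 1))

    MMU-degree+2≤D : ∀ {p q s} → deg p ℕ.≤ s → deg q ℕ.≤ s → s ℕ.≤ r →
                     deg (p *ᵖ q *ᵖ U) ℕ.+ 2 ℕ.≤ D
    MMU-degree+2≤D {p} {q} hp hq s≤r = ℕ.≤-trans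
      (ℕ.+-monoˡ-≤ 2 (MMU-degree {p} {q} (ℕ.≤-trans hp s≤r) (ℕ.≤-trans hq s≤r)))
      (ℕ.≤-trans (ℕ.≤-reflexive (ℕ.+-comm _ 2)) (ℕ.n≤1+n _))

    m+2≤D⇒m≤D : ∀ {m} → m ℕ.+ 2 ℕ.≤ D → m ℕ.≤ D
    m+2≤D⇒m≤D = ℕ.≤-trans (ℕ.m≤m+n _ 2)

    -- Both endpoints of an edge inside `I` are split off from one copy of `M I`. The other copy
    -- stays intact in the multiplier `f` of the edge axiom.
    E-dependent : ∀ I → ∣ I ∣ ≡ r → E (M I *ᵖ M I *ᵖ U) ≈ 0ℝ
    E-dependent I ∣I∣≡r with independent-false G I (dependent I ∣I∣≡r)
    ... | i , j , i≢j , ij , i∈I , j∈I = ≈-trans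
      (E-cong (m+2≤D⇒m≤D (MMU-degree+2≤D {M I} {M I} M≤r M≤r ℕ.≤-refl)) f≤D factor)
      (E-edge f i j c ij f≤D)
      where
      open Solver
      I-i   = I [ i ]≔ outside
      I-i-j = I-i [ j ]≔ outside
      f = M I *ᵖ M I-i-j *ᵖ U
      M≤r : deg (M I) ℕ.≤ r
      M≤r = ℕ.≤-reflexive (trans (M-degree I) ∣I∣≡r)
      f≤D : deg f ℕ.+ 2 ℕ.≤ D
      f≤D = MMU-degree+2≤D {M I} {M I-i-j} M≤r
        (ℕ.≤-trans (ℕ.≤-reflexive (M-degree I-i-j)) (ℕ.≤-trans (∣remove∣≤ I-i j)
          (ℕ.≤-trans (∣remove∣≤ I i) (ℕ.≤-reflexive ∣I∣≡r)))) ℕ.≤-refl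
      factor : M I *ᵖ M I *ᵖ U ≈ᵖ f *ᵖ (x i c *ᵖ x j c)
      factor = ≈ᵖ-trans
        (Ring.*-congʳ (Ring.*-congˡ {M I} (≈ᵖ-trans (monomial-remove _ I i i∈I)
          (Ring.*-congˡ (monomial-remove _ I-i j (trans (lookup∘update′ (i≢j ∘ sym) I outside) j∈I))))))
        (solve 5 (λ m xi xj s u → m :* (xi :* (xj :* s)) :* u := m :* s :* u :* (xi :* xj))
          ≈ᵖ-refl (M I) (x i c) (x j c) (M I-i-j) U)

    Q : Subset n → ℝ
    Q I = E (M I *ᵖ M I *ᵖ U)

    -- The i-th summand of x_I² S U, where S = `size c`.
    extension : Subset n → Fin n → Polynomial
    extension I i = M I *ᵖ M I *ᵖ (x i c *ᵖ U)

    extension-degree : ∀ I i → ∣ I ∣ ℕ.≤ r → deg (extension I i) ℕ.≤ D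
    extension-degree I i h = ℕ.≤-trans
      (ℕ.+-mono-≤ (ℕ.+-mono-≤ M≤r M≤r) (ℕ.s≤s U-degree))
      (ℕ.≤-trans (ℕ.≤-reflexive (ℕ.+-comm (r ℕ.+ r) 2)) (ℕ.m≤n+m _ 2))
      where
      M≤r : deg (M I) ℕ.≤ r
      M≤r = ℕ.≤-trans (ℕ.≤-reflexive (M-degree I)) h

    E-extension-outside : ∀ I i → ∣ I ∣ ℕ.< r → lookup I i ≡ outside →
                          E (extension I i) ≈ Q (I [ i ]≔ inside)
    E-extension-outside I i ∣I∣<r i∉I = begin
      E (extension I i)
        ≈⟨ E-cong (extension-degree I i (ℕ.<⇒≤ ∣I∣<r)) (ℕ.≤-trans (ℕ.+-monoʳ-≤ (deg f) (ℕ.n≤1+n 1)) f≤D)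
             (solve 3 (λ m y u → m :* m :* (y :* u) := m :* m :* u :* y) ≈ᵖ-refl (M I) (x i c) U) ⟩
      -- The Boolean axiom read from right to left: squaring the variable gives each copy of `M I`
      -- one factor to absorb.
      E (f *ᵖ x i c)                             ≈⟨ E-boolean f i c f≤D ⟨
      E (f *ᵖ (x i c *ᵖ x i c))
        ≈⟨ E-cong f≤D (m+2≤D⇒m≤D (MMU-degree+2≤D {M I+i} {M I+i} MI+i≤r MI+i≤r ℕ.≤-refl))
             (≈ᵖ-trans
               (solve 3 (λ m y u → m :* m :* u :* (y :* y) := (y :* m) :* (y :* m) :* u) ≈ᵖ-refl (M I) (x i c) U)
               (Ring.*-congʳ (*ᵖ-cong MI+i≈ MI+i≈))) ⟩
      Q I+i                                        ∎
      where
      open import Relation.Binary.Reasoning.Setoid ≈-setoid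
      open Solver using (solve; _:=_; _:*_)
      I+i = I [ i ]≔ inside
      f = M I *ᵖ M I *ᵖ U
      MI≤ : deg (M I) ℕ.≤ ∣ I ∣
      MI≤ = ℕ.≤-reflexive (M-degree I)
      f≤D : deg f ℕ.+ 2 ℕ.≤ D
      f≤D = MMU-degree+2≤D {M I} {M I} MI≤ MI≤ (ℕ.<⇒≤ ∣I∣<r)
      MI+i≤r : deg (M I+i) ℕ.≤ r
      MI+i≤r = ℕ.≤-trans (ℕ.≤-reflexive (trans (M-degree I+i) (∣insert∣ I i i∉I))) ∣I∣<r
      MI+i≈ : x i c *ᵖ M I ≈ᵖ M I+i
      MI+i≈ = ≈ᵖ-sym (monomial-insert _ I i i∉I)

    -- Each copy of `M I` already contains the variable, so it occurs to the third power, and the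
    -- Boolean axiom lowers this to the second.
    E-extension-inside : ∀ I i → ∣ I ∣ ℕ.< r → lookup I i ≡ inside →
                         E (extension I i) ≈ Q I
    E-extension-inside I i ∣I∣<r i∈I = begin
      E (extension I i)
        ≈⟨ E-cong (extension-degree I i (ℕ.<⇒≤ ∣I∣<r)) f≤D
             (≈ᵖ-trans (Ring.*-congʳ (*ᵖ-cong M≈ M≈))
               (solve 3 (λ m y u → (y :* m) :* (y :* m) :* (y :* u) := y :* m :* m :* u :* (y :* y))
                 ≈ᵖ-refl R (x i c) U)) ⟩
      E (f *ᵖ (x i c *ᵖ x i c))                  ≈⟨ E-boolean f i c f≤D ⟩
      E (f *ᵖ x i c)
        ≈⟨ E-cong (ℕ.≤-trans (ℕ.+-monoʳ-≤ (deg f) (ℕ.n≤1+n 1)) f≤D)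
             (m+2≤D⇒m≤D (MMU-degree+2≤D {M I} {M I} MI≤ MI≤ (ℕ.<⇒≤ ∣I∣<r)))
             (≈ᵖ-trans
               (solve 3 (λ m y u → y :* m :* m :* u :* y := (y :* m) :* (y :* m) :* u) ≈ᵖ-refl R (x i c) U)
               (Ring.*-congʳ (≈ᵖ-sym (*ᵖ-cong M≈ M≈)))) ⟩
      Q I                                        ∎
      where
      open import Relation.Binary.Reasoning.Setoid ≈-setoid
      open Solver using (solve; _:=_; _:*_)
      R = M (I [ i ]≔ outside)
      f = x i c *ᵖ R *ᵖ R *ᵖ U
      M≈ : M I ≈ᵖ x i c *ᵖ R
      M≈ = monomial-remove _ I i i∈I
      MI≤ : deg (M I) ℕ.≤ ∣ I ∣
      MI≤ = ℕ.≤-reflexive (M-degree I)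
      R≤ : deg R ℕ.≤ ∣ I ∣
      R≤ = ℕ.≤-trans (ℕ.≤-reflexive (M-degree (I [ i ]≔ outside))) (∣remove∣≤ I i)
      f≤D : deg f ℕ.+ 2 ℕ.≤ D
      -- `∣remove∣≤` bounds the degree of `R` only by ∣I∣, so `x i c *ᵖ R` is allowed ∣I∣ + 1, which
      -- `∣I∣<r` keeps within r.
      f≤D = MMU-degree+2≤D {x i c *ᵖ R} {R} (ℕ.s≤s R≤) (ℕ.m≤n⇒m≤1+n R≤) ∣I∣<r

    -- The sum is E[M² size U], and M² size U = (M U)² + r M² U.

    ∑E-extension : ∀ I → ∣ I ∣ ℕ.< r → fromℕ r * Q I ≤ ℝ-Sum.sum (λ i → E (extension I i))
    ∑E-extension I ∣I∣<r = begin
      fromℕ r * Q I                        ≈⟨ ℝ-Ring.+-identityˡ _ ⟨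
      0ℝ + fromℕ r * Q I
        ≤⟨ +-mono-≤ (E-square (M I *ᵖ U) g≤D) (≈⇒≤ (≈-sym (E-scale (fromℕ r) (M I *ᵖ M I *ᵖ U) f≤D))) ⟩
      E ((M I *ᵖ U) *ᵖ (M I *ᵖ U)) + E (con (fromℕ r) *ᵖ (M I *ᵖ M I *ᵖ U))
        ≈⟨ E-+ _ _ g≤D f≤D ⟨
      E ((M I *ᵖ U) *ᵖ (M I *ᵖ U) +ᵖ con (fromℕ r) *ᵖ (M I *ᵖ M I *ᵖ U))
        ≈⟨ E-cong (ℕ.⊔-lub g≤D f≤D) (∑ᵖ-degree {f = extension I} e≤D) (≈ᵖ-sym expand) ⟩
      E (∑ᵖ (extension I))                 ≈⟨ E-∑ (extension I) e≤D ⟩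
      ℝ-Sum.sum (λ i → E (extension I i))  ∎
      where
      open ≤-Reasoning
      open Solver using (solve; _:=_; _:*_; _:+_)
      e≤D : ∀ i → deg (extension I i) ℕ.≤ D
      e≤D i = extension-degree I i (ℕ.<⇒≤ ∣I∣<r)
      MI≤ : deg (M I) ℕ.≤ ∣ I ∣
      MI≤ = ℕ.≤-reflexive (M-degree I)
      f≤D : deg (M I *ᵖ M I *ᵖ U) ℕ.≤ D
      f≤D = m+2≤D⇒m≤D (MMU-degree+2≤D {M I} {M I} MI≤ MI≤ (ℕ.<⇒≤ ∣I∣<r))
      MU≤r : deg (M I *ᵖ U) ℕ.≤ r
      MU≤r = ℕ.≤-trans (ℕ.≤-trans (ℕ.+-mono-≤ MI≤ U-degree) (ℕ.≤-reflexive (ℕ.+-comm ∣ I ∣ 1))) ∣I∣<r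
      g≤D : deg (M I *ᵖ U) ℕ.+ deg (M I *ᵖ U) ℕ.≤ D
      g≤D = ℕ.≤-trans (ℕ.+-mono-≤ MU≤r MU≤r) (ℕ.m≤n+m _ 4)
      expand : ∑ᵖ (extension I) ≈ᵖ (M I *ᵖ U) *ᵖ (M I *ᵖ U) +ᵖ con (fromℕ r) *ᵖ (M I *ᵖ M I *ᵖ U)
      expand = ≈ᵖ-trans (≈ᵖ-sym (Sum.*-distribˡ-sum (M I *ᵖ M I) (λ i → x i c *ᵖ U)))
        (≈ᵖ-trans (Ring.*-congˡ (≈ᵖ-trans (≈ᵖ-sym (Sum.*-distribʳ-sum U (λ i → x i c))) (Ring.*-congʳ size≈U+r)))
          (solve 3 (λ m u a → m :* m :* ((u :+ a) :* u) := (m :* u) :* (m :* u) :+ a :* (m :* m :* u))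
            ≈ᵖ-refl (M I) U (con (fromℕ r))))

    -- Here `s` is the gap r - ∣I∣, so structural recursion on `s` is the downward induction on ∣I∣.
    Q≤0 : ∀ s I → s ℕ.+ ∣ I ∣ ≡ r → Q I ≤ 0ℝ
    Q≤0 zero    I ∣I∣≡r = ≈⇒≤ (E-dependent I ∣I∣≡r)
    Q≤0 (suc s) I eq    = multiple≤⇒≤0 (Q I) ∣I∣<r (begin
      fromℕ r * Q I                                        ≤⟨ ∑E-extension I ∣I∣<r ⟩
      ℝ-Sum.sum (λ i → E (extension I i))                  ≤⟨ sum-mono-≤ termwise ⟩
      ℝ-Sum.sum (λ i → if lookup I i then Q I else 0ℝ)     ≈⟨ sum-indicator I (Q I) ⟩
      fromℕ ∣ I ∣ * Q I                                    ∎)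
      where
      open ≤-Reasoning
      ∣I∣<r : ∣ I ∣ ℕ.< r
      ∣I∣<r = subst (∣ I ∣ ℕ.<_) eq (ℕ.s≤s (ℕ.m≤n+m ∣ I ∣ s))
      termwise : ∀ i → E (extension I i) ≤ (if lookup I i then Q I else 0ℝ)
      termwise i with lookup I i in side
      ... | inside  = ≈⇒≤ (E-extension-inside I i ∣I∣<r side)
      ... | outside = ≤-trans (≈⇒≤ (E-extension-outside I i ∣I∣<r side))
        (Q≤0 s (I [ i ]≔ inside) (trans (cong (s ℕ.+_) (∣insert∣ I i side)) (trans (ℕ.+-suc s ∣ I ∣) eq)))

    E-size≤r : E (size c) ≤ fromℕ r
    E-size≤r = begin
      E (size c)
        ≈⟨ E-cong (ℕ.≤-trans (size-degree c) 1≤D) (ℕ.⊔-lub f≤D ℕ.z≤n)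
             (≈ᵖ-trans size≈U+r (Ring.+-congʳ (≈ᵖ-sym MMU≈U))) ⟩
      E (M ⊥ *ᵖ M ⊥ *ᵖ U +ᵖ con (fromℕ r))     ≈⟨ E-+ _ _ f≤D ℕ.z≤n ⟩
      Q ⊥ + E (con (fromℕ r))
        ≤⟨ +-mono-≤ (Q≤0 r ⊥ (trans (cong (r ℕ.+_) (∣⊥∣≡0 n)) (ℕ.+-identityʳ r))) (≈⇒≤ (E-con (fromℕ r))) ⟩
      0ℝ + fromℕ r                             ≈⟨ ℝ-Ring.+-identityˡ _ ⟩
      fromℕ r                                  ∎
      where
      open ≤-Reasoning
      -- Vertices outside the set add no factor, so the empty monomial is `1ᵖ` as an expression.
      M⊥≡1 : ∀ m (v : Fin m → Fin n × Fin k) → monomial v ⊥ ≡ 1ᵖ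
      M⊥≡1 zero    v = refl
      M⊥≡1 (suc m) v = M⊥≡1 m (v ∘ Fin.suc)
      M≤0 : deg (M ⊥) ℕ.≤ 0
      M≤0 = ℕ.≤-reflexive (cong deg (M⊥≡1 n _))
      f≤D : deg (M ⊥ *ᵖ M ⊥ *ᵖ U) ℕ.≤ D
      f≤D = m+2≤D⇒m≤D (MMU-degree+2≤D {M ⊥} {M ⊥} M≤0 M≤0 ℕ.z≤n)
      MMU≈U : M ⊥ *ᵖ M ⊥ *ᵖ U ≈ᵖ U
      MMU≈U = subst (λ m → m *ᵖ m *ᵖ U ≈ᵖ U) (sym (M⊥≡1 n _))
        (≈ᵖ-trans (Ring.*-congʳ (Ring.*-identityˡ 1ᵖ)) (Ring.*-identityˡ U))

  -- Double counting of the values `E (x i c)`: every vertex accounts for at least 1, every color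
  -- for at most r.
  n≤k*r : n ℕ.≤ k ℕ.* r
  n≤k*r = fromℕ-cancel-≤ (begin
    fromℕ n                                                     ≡⟨ cong fromℕ (ℕ.*-identityʳ n) ⟨
    fromℕ (n ℕ.* 1)                                             ≈⟨ sum-const n 1 ⟨
    ℝ-Sum.sum {n} (λ _ → 1ℝ)                                    ≤⟨ sum-mono-≤ (E-colored 1≤D) ⟩
    ℝ-Sum.sum (λ i → E (∑ᵖ (x i)))
      ≈⟨ ℝ-Sum.sum-cong-≋ (λ i → E-∑ (x i) λ _ → 1≤D) ⟩
    ℝ-Sum.sum (λ i → ℝ-Sum.sum (λ c → E (x i c)))               ≈⟨ ℝ-Sum.∑-comm (λ i c → E (x i c)) ⟩
    ℝ-Sum.sum (λ c → ℝ-Sum.sum (λ i → E (x i c)))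
      ≈⟨ ℝ-Sum.sum-cong-≋ (λ c → ≈-sym (E-∑ (λ i → x i c) λ _ → 1≤D)) ⟩
    ℝ-Sum.sum (λ c → E (size c))                                ≤⟨ sum-mono-≤ E-size≤r ⟩
    ℝ-Sum.sum {k} (λ _ → fromℕ r)                               ≈⟨ sum-const k r ⟩
    fromℕ (k ℕ.* r)                                             ∎)
    where open ≤-Reasoning

-- Bounds on `log₂` and `e`, and the conclusion.

-- From 2^l ≤ n follows 2^(l (m + 1)) ≤ n^(m + 1), so the bound holds for each term of the
-- approximating sequence and not only in the limit.
⌊log₂⌋≤log₂ : ∀ n → 1 ℕ.≤ n → ∀ m → ι ⌊log₂ n ⌋ ℚ.≤ seq (log₂ n) m
⌊log₂⌋≤log₂ n 1≤n m = /-mono-≤ l 1 ⌊log₂ n ℕ.^ suc m ⌋ (suc m) (begin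
  l ℕ.* suc m                       ≡⟨ ⌊log₂[2^n]⌋≡n (l ℕ.* suc m) ⟨
  ⌊log₂ 2 ℕ.^ (l ℕ.* suc m) ⌋       ≡⟨ cong ⌊log₂_⌋ (ℕ.^-*-assoc 2 l (suc m)) ⟨
  ⌊log₂ (2 ℕ.^ l) ℕ.^ suc m ⌋       ≤⟨ ⌊log₂⌋-mono-≤ (ℕ.^-monoˡ-≤ (suc m) (2^⌊log₂n⌋≤n n 1≤n)) ⟩
  ⌊log₂ n ℕ.^ suc m ⌋               ≡⟨ ℕ.*-identityʳ _ ⟨
  ⌊log₂ n ℕ.^ suc m ⌋ ℕ.* 1         ∎)
  where
  open ℕ.≤-Reasoning
  l = ⌊log₂ n ⌋

-- The partial sums increase and equal 1 + 1 at index 1; at index 0 the sum is only 1.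
2≤e : ∀ {m} → 1 ℕ.≤ m → ι 2 ℚ.≤ seq e m
2≤e 1≤m = ∑-mono (ℕ.≤⇒≤′ 1≤m)

scaled-log₂-bound : ∀ a n → 1 ℕ.≤ n → ∀ m →
  ι (a ℕ.* ⌊log₂ n ⌋) ℚ.≤ seq (fromℕ a * (1ℝ + 0ℝ) * log₂ n) m
scaled-log₂-bound a n 1≤n m = subst₂ ℚ._≤_ (sym (ι-* a ⌊log₂ n ⌋))
  -- The factor `1ℝ + 0ℝ` evaluates to `1ℚ` in each term and is absorbed by the identity law.
  (cong (ℚ._* seq (log₂ n) m) (sym (ℚ.*-identityʳ (ι a))))
  (*-mono-≤-nonNeg (0≤ι a) ℚ.≤-refl (0≤ι ⌊log₂ n ⌋) (⌊log₂⌋≤log₂ n 1≤n m))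

degree-bound : ∀ n → 1 ℕ.≤ n → fromℕ (8 ℕ.* ⌊log₂ n ⌋) ≤ fromℕ 8 * (1ℝ + 0ℝ) * log₂ n
degree-bound n 1≤n = seq≤⇒≤ (0 , λ m _ → scaled-log₂-bound 8 n 1≤n m)

color-bound : ∀ k n → 1 ℕ.≤ n →
  fromℕ (k ℕ.* (2 ℕ.* (2 ℕ.* ⌊log₂ n ⌋))) ≤ fromℕ k * (e * (fromℕ 2 * (1ℝ + 0ℝ) * log₂ n))
color-bound k n 1≤n = seq≤⇒≤ (1 , λ m 1≤m → begin
  ι (k ℕ.* (2 ℕ.* a))                          ≡⟨ ι-* k (2 ℕ.* a) ⟩
  ι k ℚ.* ι (2 ℕ.* a)                          ≡⟨ cong (ι k ℚ.*_) (ι-* 2 a) ⟩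
  ι k ℚ.* (ι 2 ℚ.* ι a)
    ≤⟨ ℚ.*-monoˡ-≤-nonNeg (ι k) {{ℚ.nonNegative (0≤ι k)}}
         (*-mono-≤-nonNeg (0≤ι 2) (2≤e 1≤m) (0≤ι a) (scaled-log₂-bound 2 n 1≤n m)) ⟩
  ι k ℚ.* (seq e m ℚ.* seq (fromℕ 2 * (1ℝ + 0ℝ) * log₂ n) m) ∎)
  where
  open ℚ.≤-Reasoning
  a = 2 ℕ.* ⌊log₂ n ⌋

threshold≡ : ∀ n → threshold n ≡ 5 ℕ.+ 2 ℕ.* ⌊log₂ n ⌋
threshold≡ n = eq ⌊log₂ n ⌋
  where
  eq : ∀ l → suc ((2 ℕ.+ l) ℕ.+ (2 ℕ.+ l)) ≡ 5 ℕ.+ 2 ℕ.* l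
  eq = solve-∀

-- With r = 2l + 5, the degree bound amounts to 14 ≤ 4l and the color bound to 5 < 2l; both hold
-- from l = 4 on.
module _ {l} (4≤l : 4 ℕ.≤ l) where

  open ℕ.≤-Reasoning

  4+2r≤8l : 4 ℕ.+ ((5 ℕ.+ 2 ℕ.* l) ℕ.+ (5 ℕ.+ 2 ℕ.* l)) ℕ.≤ 8 ℕ.* l
  4+2r≤8l = begin
    4 ℕ.+ ((5 ℕ.+ 2 ℕ.* l) ℕ.+ (5 ℕ.+ 2 ℕ.* l)) ≡⟨ left l ⟩
    14 ℕ.+ 4 ℕ.* l                  ≤⟨ ℕ.+-monoˡ-≤ (4 ℕ.* l) (ℕ.m≤n+m 14 2) ⟩
    4 ℕ.* 4 ℕ.+ 4 ℕ.* l             ≤⟨ ℕ.+-monoˡ-≤ (4 ℕ.* l) (ℕ.*-monoʳ-≤ 4 4≤l) ⟩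
    4 ℕ.* l ℕ.+ 4 ℕ.* l             ≡⟨ right l ⟩
    8 ℕ.* l                         ∎
    where
    left : ∀ l → 4 ℕ.+ ((5 ℕ.+ 2 ℕ.* l) ℕ.+ (5 ℕ.+ 2 ℕ.* l)) ≡ 14 ℕ.+ 4 ℕ.* l
    left = solve-∀
    right : ∀ l → 4 ℕ.* l ℕ.+ 4 ℕ.* l ≡ 8 ℕ.* l
    right = solve-∀

  r<4l : 5 ℕ.+ 2 ℕ.* l ℕ.< 2 ℕ.* (2 ℕ.* l)
  r<4l = begin-strict
    5 ℕ.+ 2 ℕ.* l                   <⟨ ℕ.+-monoˡ-< (2 ℕ.* l) (ℕ.m≤n+m 6 2) ⟩
    2 ℕ.* 4 ℕ.+ 2 ℕ.* l             ≤⟨ ℕ.+-monoˡ-≤ (2 ℕ.* l) (ℕ.*-monoʳ-≤ 2 4≤l) ⟩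
    2 ℕ.* l ℕ.+ 2 ℕ.* l             ≡⟨ right l ⟩
    2 ℕ.* (2 ℕ.* l)                 ∎
    where
    right : ∀ l → 2 ℕ.* l ℕ.+ 2 ℕ.* l ≡ 2 ℕ.* (2 ℕ.* l)
    right = solve-∀

no-pseudoExpectation : ∀ {n} (G : Graph n) → 16 ℕ.≤ n → T (hasNoIndependent (threshold n) G) →
  ∀ k → k ℕ.≥ 1 → fromℕ k * (e * (fromℕ 2 * (1ℝ + 0ℝ) * log₂ n)) ≤ fromℕ n →
  ¬ ColoringPseudoExpectation (fromℕ 8 * (1ℝ + 0ℝ) * log₂ n) G k
no-pseudoExpectation {n} G 16≤n h k@(suc _) _ k≤ P = ℕ.<-irrefl refl (begin-strict
  n
    ≤⟨ ColorClass.n≤k*r P r (≤-trans (fromℕ-mono-≤ (4+2r≤8l 4≤l)) (degree-bound n 1≤n)) dependent ⟩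
  -- Strict because `k` is matched as a successor.
  k ℕ.* r                                <⟨ ℕ.*-monoʳ-< k (r<4l 4≤l) ⟩
  k ℕ.* (2 ℕ.* (2 ℕ.* ⌊log₂ n ⌋))        ≤⟨ fromℕ-cancel-≤ (≤-trans (color-bound k n 1≤n) k≤) ⟩
  n                                      ∎)
  where
  open ℕ.≤-Reasoning
  r = 5 ℕ.+ 2 ℕ.* ⌊log₂ n ⌋
  1≤n : 1 ℕ.≤ n
  1≤n = ℕ.≤-trans (ℕ.m≤m+n 1 15) 16≤n
  4≤l : 4 ℕ.≤ ⌊log₂ n ⌋
  -- 16 = 2^4 is the least n with ⌊log₂ n⌋ ≥ 4.
  4≤l = ⌊log₂⌋-mono-≤ 16≤n
  dependent : ∀ I → ∣ I ∣ ≡ r → independent G I ≡ false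
  dependent I eq = hasNoIndependent-sound G I
    (subst (λ r → T (hasNoIndependent r G)) (trans (threshold≡ n) (sym eq)) h)

0⟶0 : (λ _ → 0ℝ) ⟶0
0⟶0 ε 0<ε = 0 , λ _ _ →
  seq≤⇒≤ (0 , λ _ _ → ℚ.neg-antimono-≤ (ℚ.<⇒≤ 0<ε)) ,
  seq≤⇒≤ (0 , λ _ _ → ℚ.<⇒≤ 0<ε)

-- For large n the Boolean event found inside `A` lies inside `B` as well, with the same
-- probability.
whp-mono : ∀ {A B : ∀ n → Graph n → Set} → Eventually (λ n → ∀ G → A n G → B n G) →
           WithHighProbability A → WithHighProbability B
whp-mono (M , f) h ε 0<ε = let N , p = h ε 0<ε in M ℕ.⊔ N , λ n M⊔N≤n →
  let C , C⇒A , q = p n (ℕ.m⊔n≤o⇒n≤o M N M⊔N≤n)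
  in C , (λ G → f n (ℕ.m⊔n≤o⇒m≤o M N M⊔N≤n) G ∘ C⇒A G) , q

lemmaB1 : Σ (ℕ → ℝ) λ δ → Σ (ℕ → ℝ) λ δ′ →
    δ ⟶0 × δ′ ⟶0 ×
    WithHighProbability λ n G →
    ∀ (k : ℕ) → k ℕ.≥ 1 →
    fromℕ k * (e * (fromℕ 2 * (1ℝ + δ′ n) * log₂ n)) ≤ fromℕ n →
    ¬ ColoringPseudoExpectation (fromℕ 8 * (1ℝ + δ n) * log₂ n) G k
lemmaB1 = (λ _ → 0ℝ) , (λ _ → 0ℝ) , 0⟶0 , 0⟶0 ,
  whp-mono (16 , λ _ 16≤n G → no-pseudoExpectation G 16≤n) hasNoIndependent-whp
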